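{- (a) $L_C^+(3)\geq\frac{57}{1000}$ and $L_C^-(3)\geq\frac{7}{125}$, so $R_C^+(3)>1.15455$ and $R_C^-(3)>1.14775$. (b) $L_C^+(4)\geq L_C^-(4)\geq\frac{25}{3456}$, so $R_C^+(4)\geq R_C^-(4)>1.16654$. (c) $L_C^+(5)\geq L_C^-(5)\geq\frac{109}{134456}$, so $R_C^+(5)\geq R_C^-(5)>1.20431$.
   Context: A circulant graph is a Cayley graph $\mathrm{Cay}(\mathbb{Z}_n,S)$ of a cyclic group ($0\notin S$, vertex $g$ joined to $g+s$ for $s\in S$); it is undirected if $S=-S$. $CC(d,k)$ denotes the largest order of an undirected circulant graph with degree $d$ and diameter $k$. Define $L^-_C(k)=\liminf_{d\to\infty}CC(d,k)/d^k$, $L^+_C(k)=\limsup_{d\to\infty}CC(d,k)/d^k$, $R^-_C(k)=k\,L^-_C(k)^{1/k}$ and $R^+_C(k)=k\,L^+_C(k)^{1/k}$. -}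

module Defs where

open import Data.Nat as ℕ using (ℕ; zero; suc; _∸_)
open import Data.Integer using (+_)
open import Data.Rational as ℚ using (ℚ; _/_; 1ℚ; 0ℚ)
open import Data.List using (List; length)
open import Data.Nat.ListAction using (sum)
open import Data.List.Relation.Unary.All using (All)
open import Data.List.Relation.Unary.Unique.Propositional using (Unique)
open import Data.List.Membership.Propositional using (_∈_)
open import Data.Product using (Σ; ∃; _×_)
open import Relation.Binary.PropositionalEquality using (_≡_)

-- A connection set S ⊆ ℤ_n \ {0}, elements represented by 0 < s < n.
-- Circulant d k n : there is an undirected circulant graph Cay(ℤ_n, S)
-- with degree d (|S| = d) and diameter at most k (every x ∈ ℤ_n is a sum
-- of at most k elements of S, i.e. at distance ≤ k from 0; vertex-transitive).
record Circulant (d k n : ℕ) : Set where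
  field
    S       : List ℕ
    range   : All (λ s → 0 ℕ.< s × s ℕ.< n) S
    unique  : Unique S
    symm    : All (λ s → (n ∸ s) ∈ S) S
    degree  : length S ≡ d
    diam    : ∀ x → x ℕ.< n →
                Σ (List ℕ) λ ws → length ws ℕ.≤ k × All (_∈ S) ws ×
                  ∃ λ q → sum ws ≡ x ℕ.+ q ℕ.* n

ℕtoℚ : ℕ → ℚ
ℕtoℚ n = + n / 1

_^ℚ_ : ℚ → ℕ → ℚ
q ^ℚ zero  = 1ℚ
q ^ℚ suc m = q ℚ.* (q ^ℚ m)

-- "CC(d,k) ≥ (q - ε) d^k": since CC(d,k) is the largest order n admitting
-- such a graph, this says some such graph has order n ≥ (q - ε) d^k.
CCbound : ℕ → ℕ → ℚ → Set
CCbound k d r = ∃ λ n → Circulant d k n × r ℚ.* ℕtoℚ (d ℕ.^ k) ℚ.≤ ℕtoℚ n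

LminusGE : ℕ → ℚ → Set
LminusGE k q = ∀ ε → 0ℚ ℚ.< ε → ∃ λ D → ∀ d → D ℕ.≤ d → CCbound k d (q ℚ.- ε)

LplusGE : ℕ → ℚ → Set
LplusGE k q = ∀ ε → 0ℚ ℚ.< ε → ∀ D → ∃ λ d → D ℕ.≤ d × CCbound k d (q ℚ.- ε)

LminusGT : ℕ → ℚ → Set
LminusGT k q = ∃ λ δ → 0ℚ ℚ.< δ × LminusGE k (q ℚ.+ δ)

LplusGT : ℕ → ℚ → Set
LplusGT k q = ∃ λ δ → 0ℚ ℚ.< δ × LplusGE k (q ℚ.+ δ)

-- R(k) = k L(k)^{1/k} > r  ⇔  L(k) > (r/k)^k   (r given as a / b; only k ≥ 1 used)
RminusGT : ℕ → ℕ → (b : ℕ) → .{{_ : ℕ.NonZero b}} → Set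
RminusGT zero    a b = LminusGT zero 0ℚ
RminusGT (suc j) a b = LminusGT (suc j) (((+ a / b) ℚ.* (+ 1 / suc j)) ^ℚ suc j)

RplusGT : ℕ → ℕ → (b : ℕ) → .{{_ : ℕ.NonZero b}} → Set
RplusGT zero    a b = LplusGT zero 0ℚ
RplusGT (suc j) a b = LplusGT (suc j) (((+ a / b) ℚ.* (+ 1 / suc j)) ^ℚ suc j)

-- L⁺(k) ≥ L⁻(k) (hence R⁺(k) ≥ R⁻(k)): every lower bound for L⁻ is one for L⁺
LplusGEminus : ℕ → Set
LplusGEminus k = ∀ q → LminusGE k q → LplusGE k q

{-# OPTIONS --safe #-}
module Submission where

-- Fix D = (k+1)! and a large m ≡ 1 mod 2D.  Consider integers g₀, …, g₍ₖ₊₁₎ ("lines") with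
-- Σ gᵢ = 0 = Σ i gᵢ.  Eliminating with these two relations expresses every D gᵢ through any k of
-- the lines, and the lines can be chosen so that m gᵢ is, modulo mᵏ, a bounded combination of the
-- D gⱼ.  Hence any k of the lines represent every residue modulo mᵏ with coefficients of absolute
-- value at most m/2 + O(1).  Let t₀, …, t₍ₖ₊₁₎ be residues such that every element of ℤ_T is a signed
-- sum of exactly k distinct tᵢ.  Then every element of ℤ_n, n = T mᵏ, is a sum of k of the elements
-- ±(tᵢ + T gᵢ y) with |y| ≤ m/2 + O(1).  There are about 2(k+2)m of these, so the density is
-- T / (2(k+2))ᵏ.  As m need not be prime, no information on prime gaps is required for L⁻.

open import Defs
open import Data.Integer using (+_)
open import Data.Rational using (_/_)
open import Data.Product using (_×_)

open import Data.Bool using (Bool; true; false)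
open import Data.Fin using (Fin; zero; suc; toℕ; punchIn)
import Data.Fin.Properties as Fin
open import Data.Integer as ℤ using (ℤ; _+_; _*_; _-_; -_; _^_; ∣_∣; 0ℤ; 1ℤ; -[1+_]; +[1+_])
open import Data.Integer.Divisibility.Signed using (_∣_; quotient; ∣ᵤ⇒∣)
import Data.Integer.DivMod as ℤ
import Data.Integer.Properties as ℤ
open import Data.Integer.Tactic.RingSolver using (solve-∀)
open import Algebra.Properties.Semiring.Sum ℤ.+-*-semiring
  using (sum; sum-cong-≗; sum-replicate-zero; sum-remove; ∑-distrib-+; *-distribˡ-sum)
open import Data.Nat as ℕ using (ℕ; zero; suc; z≤n; s≤s)
open import Data.Nat.Base using (_!)
import Data.Nat.Divisibility as ℕ
import Data.Nat.DivMod as ℕ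
open import Data.Nat.ListAction using () renaming (sum to sumℕ)
import Data.Nat.Properties as ℕ
open import Data.Nat.Tactic.RingSolver using () renaming (solve-∀ to solve-∀ℕ)
open import Data.List
  using (List; []; _∷_; _++_; [_]; length; map; filter; take; deduplicate; upTo; allFin; cartesianProduct; cartesianProductWith)
open import Data.List.Membership.DecPropositional ℕ._≟_ using (_∈?_)
open import Data.List.Membership.Propositional using (_∈_)
open import Data.List.Membership.Propositional.Properties
open import Data.List.Properties
  using (length-++; length-map; length-take; length-upTo; length-deduplicate; length-tabulate)
open import Data.List.Relation.Binary.Permutation.Propositional.Properties using (shift; ↭-length)
open import Data.List.Relation.Binary.Subset.Propositional using (_⊆_)
open import Data.List.Relation.Binary.Subset.Propositional.Properties using (⊆∷∧∉⇒⊆; ⊆-respʳ-↭)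
open import Data.List.Relation.Unary.All as All using (All; []; _∷_)
import Data.List.Relation.Unary.All.Properties as All
open import Data.List.Relation.Unary.AllPairs using ([]; _∷_)
open import Data.List.Relation.Unary.Any using (here; there)
open import Data.List.Relation.Unary.Unique.DecPropositional.Properties ℕ._≟_ using (deduplicate-!)
open import Data.List.Relation.Unary.Unique.Propositional using (Unique)
import Data.List.Relation.Unary.Unique.Propositional.Properties as Unique
open import Data.Product using (Σ; ∃; _,_; proj₁; proj₂)
open import Data.Rational as ℚ using (ℚ; mkℚ; 0ℚ; ↥_; ↧_; ↧ₙ_; toℚᵘ)
import Data.Rational.Properties as ℚ
open import Data.Rational.Unnormalised as ℚᵘ using (mkℚᵘ; *≤*)
import Data.Rational.Unnormalised.Properties as ℚᵘ
open import Data.Sum using (_⊎_; inj₁; inj₂; [_,_]′)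
open import Data.Vec using (Vec; []; _∷_; lookup)
open import Function using (_∘_; _$_)
open import Relation.Binary.PropositionalEquality hiding ([_])
open import Relation.Nullary using (Dec; yes; no; ¬_; ¬?; contradiction)
open import Relation.Nullary.Decidable using (True; toWitness)

-- With the weights 0, ..., k+1 in the two relations, the minor belonging to a pair of lines is a
-- difference of indices: nonzero, and a divisor of `D`. Any two lines can therefore be eliminated
-- at the price of one factor `D`.
--
-- The obstacle is size. Elimination turns coefficients up to m into coefficients of several
-- multiples of m, while the degree allows only m/2 + O(1). They are cut back to least residues
-- modulo m, and the multiples of m removed form a new combination with bounded coefficients. The
-- basis m^j D^(k-1-j) is made for this carry: m times an entry is D times the next entry, and m
-- times the last one is m^k. The carry returns with exactly the factor D that a second elimination
-- of the same two lines uses up, and that elimination adds only O(1).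
--
-- The congruence m ≡ 1 mod 2D makes D invertible modulo m, and it makes m odd, so that remainders
-- lie symmetrically about 0. Rounding a given degree down to an admissible m costs O(1) in m, hence
-- nothing in the limit; the free places of the connection set are filled with arbitrary elements.

infix 9 _∙_

-- Integer linear forms and their size

_∙_ : ∀ {n} → (Fin n → ℤ) → (Fin n → ℤ) → ℤ
x ∙ g = sum λ i → x i * g i

∙-linear : ∀ {n} a b (x y g : Fin n → ℤ) →
           (λ i → a * x i + b * y i) ∙ g ≡ a * x ∙ g + b * y ∙ g
∙-linear a b x y g = begin
  sum (λ i → (a * x i + b * y i) * g i)                  ≡⟨ sum-cong-≗ (λ i → distr a b (x i) (y i) (g i)) ⟩
  sum (λ i → a * (x i * g i) + b * (y i * g i))          ≡⟨ ∑-distrib-+ (λ i → a * (x i * g i)) (λ i → b * (y i * g i)) ⟩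
  sum (λ i → a * (x i * g i)) + sum (λ i → b * (y i * g i))
    ≡⟨ cong₂ _+_ (*-distribˡ-sum a (λ i → x i * g i)) (*-distribˡ-sum b (λ i → y i * g i)) ⟨
  a * x ∙ g + b * y ∙ g                                  ∎
  where
  open ≡-Reasoning
  distr : ∀ a b x y g → (a * x + b * y) * g ≡ a * (x * g) + b * (y * g)
  distr = solve-∀

∙-cong : ∀ {n} {x y : Fin n → ℤ} (g : Fin n → ℤ) → (∀ i → x i ≡ y i) → x ∙ g ≡ y ∙ g
∙-cong g x≗y = sum-cong-≗ λ i → cong (_* g i) (x≗y i)

∣+∣≤ : ∀ i j {a b} → ∣ i ∣ ℕ.≤ a → ∣ j ∣ ℕ.≤ b → ∣ i + j ∣ ℕ.≤ a ℕ.+ b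
∣+∣≤ i j p q = ℕ.≤-trans (ℤ.∣i+j∣≤∣i∣+∣j∣ i j) (ℕ.+-mono-≤ p q)

∣-∣≤ : ∀ i j {a b} → ∣ i ∣ ℕ.≤ a → ∣ j ∣ ℕ.≤ b → ∣ i - j ∣ ℕ.≤ a ℕ.+ b
∣-∣≤ i j p q = ℕ.≤-trans (ℤ.∣i-j∣≤∣i∣+∣j∣ i j) (ℕ.+-mono-≤ p q)

∣*∣≤ : ∀ i j {a b} → ∣ i ∣ ℕ.≤ a → ∣ j ∣ ℕ.≤ b → ∣ i * j ∣ ℕ.≤ a ℕ.* b
∣*∣≤ i j {a} {b} p q = subst (ℕ._≤ a ℕ.* b) (sym (ℤ.abs-* i j)) (ℕ.*-mono-≤ p q)

κ : ∀ {n} → Fin n → ℤ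
κ i = + toℕ i

∣κ-κ∣≤ : ∀ {n} (i j : Fin n) → ∣ κ i - κ j ∣ ℕ.≤ n
∣κ-κ∣≤ {n} i j = begin
  ∣ κ i - κ j ∣           ≡⟨ cong ∣_∣ (ℤ.[+m]-[+n]≡m⊖n (toℕ i) (toℕ j)) ⟩
  ∣ toℕ i ℤ.⊖ toℕ j ∣     ≤⟨ ℤ.∣m⊝n∣≤m⊔n (toℕ i) (toℕ j) ⟩
  toℕ i ℕ.⊔ toℕ j         ≤⟨ ℕ.⊔-lub (ℕ.<⇒≤ (Fin.toℕ<n i)) (ℕ.<⇒≤ (Fin.toℕ<n j)) ⟩
  n                       ∎
  where open ℕ.≤-Reasoning

-- Two distinct indices differ by at most k+1, and every positive number up to k+1 divides (k+1)!.
-- The cofactor `e` is the multiplier of the elimination step; its bound involves k alone.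
differences-divide : ∀ {k} (a b : Fin (suc (suc k))) → a ≢ b →
                     ∃ λ e → e * (κ a - κ b) ≡ + (suc k !) × ∣ e ∣ ℕ.≤ suc k !
differences-divide {k} a b a≢b = quotient ∣D , sym (_∣_.equality ∣D) , (begin
    ∣ quotient ∣D ∣               ≤⟨ ℕ.m≤m*n ∣ quotient ∣D ∣ d ⦃ ℕ.≢-nonZero d≢0 ⦄ ⟩
    ∣ quotient ∣D ∣ ℕ.* d         ≡⟨ ℤ.abs-* (quotient ∣D) (κ a - κ b) ⟨
    ∣ quotient ∣D * (κ a - κ b) ∣ ≡⟨ cong ∣_∣ (_∣_.equality ∣D) ⟨
    suc k !                       ∎)
  where
  open ℕ.≤-Reasoning
  d = ∣ κ a - κ b ∣
  d≢0 : d ≢ 0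
  d≢0 eq = a≢b (Fin.toℕ-injective (ℤ.+-injective (ℤ.i-j≡0⇒i≡j (κ a) (κ b) (ℤ.∣i∣≡0⇒i≡0 eq))))
  d≤ : d ℕ.≤ suc k
  d≤ = begin
    d                     ≡⟨ cong ∣_∣ (ℤ.[+m]-[+n]≡m⊖n (toℕ a) (toℕ b)) ⟩
    ∣ toℕ a ℤ.⊖ toℕ b ∣   ≤⟨ ℤ.∣m⊝n∣≤m⊔n (toℕ a) (toℕ b) ⟩
    toℕ a ℕ.⊔ toℕ b       ≤⟨ ℕ.⊔-lub (Fin.toℕ≤pred[n] a) (Fin.toℕ≤pred[n] b) ⟩
    suc k                 ∎
  self∣! : ∀ n → n ≢ 0 → n ℕ.∣ n !
  self∣! zero n≢0 with () ← n≢0 refl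
  self∣! (suc n) _ = ℕ.m∣m*n (n !)
  ∣D : (κ a - κ b) ∣ + (suc k !)
  ∣D = ∣ᵤ⇒∣ (ℕ.∣-trans (self∣! d d≢0) (ℕ.m≤n⇒m!∣n! d≤))

-- Division with remainder of least absolute value

divℕ : ∀ z n .{{_ : ℕ.NonZero n}} → z ≡ + (z ℤ.%ℕ n) + + n * (z ℤ./ℕ n)
divℕ z n = trans (ℤ.a≡a%ℕn+[a/ℕn]*n z n) (cong (λ s → + (z ℤ.%ℕ n) + s) (ℤ.*-comm (z ℤ./ℕ n) (+ n)))

∣⊖∣≤ : ∀ h q → q ℕ.≤ 2 ℕ.* h → ∣ + q - + h ∣ ℕ.≤ h
∣⊖∣≤ h q q≤ with ℕ.≤-total h q
... | inj₁ h≤q = begin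
  ∣ + q - + h ∣  ≡⟨ cong ∣_∣ (trans (ℤ.[+m]-[+n]≡m⊖n q h) (ℤ.⊖-≥ h≤q)) ⟩
  q ℕ.∸ h        ≤⟨ ℕ.m≤n+o⇒m∸n≤o q h (ℕ.≤-trans q≤ (ℕ.≤-reflexive (cong (h ℕ.+_) (ℕ.+-identityʳ h)))) ⟩
  h              ∎
  where
  open ℕ.≤-Reasoning
... | inj₂ q≤h = begin
  ∣ + q - + h ∣  ≡⟨ ℤ.∣i-j∣≡∣j-i∣ (+ q) (+ h) ⟩
  ∣ + h - + q ∣  ≡⟨ cong ∣_∣ (trans (ℤ.[+m]-[+n]≡m⊖n h q) (ℤ.⊖-≥ q≤h)) ⟩
  h ℕ.∸ q        ≤⟨ ℕ.m∸n≤m h q ⟩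
  h              ∎
  where
  open ℕ.≤-Reasoning

-- An odd modulus 2h+1 has the residue system -h, ..., h, found by dividing z + h and shifting back.
-- The last clause keeps coefficients that elimination has cleared equal to zero after reduction.
balanced : ∀ h K z → ∣ z ∣ ℕ.≤ K ℕ.* suc (2 ℕ.* h) →
           ∃ λ r → ∃ λ w → z ≡ r + + suc (2 ℕ.* h) * w × ∣ r ∣ ℕ.≤ h × ∣ w ∣ ℕ.≤ suc K × (z ≡ 0ℤ → r ≡ 0ℤ)
balanced h K z z≤ = r , w , z≡ , r≤ , w≤ , r≡0
  where
  M : ℕ
  M = suc (2 ℕ.* h)
  q = (z + + h) ℤ.%ℕ M
  r = + q - + h
  w = (z + + h) ℤ./ℕ M
  cancelʳ : ∀ z h → z ≡ (z + h) - h
  cancelʳ = solve-∀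
  regroup : ∀ q mw h → (q + mw) - h ≡ (q - h) + mw
  regroup = solve-∀
  z≡ : z ≡ r + + M * w
  z≡ = trans (cancelʳ z (+ h)) (trans (cong (_- + h) (divℕ (z + + h) M)) (regroup (+ q) (+ M * w) (+ h)))
  r≤ : ∣ r ∣ ℕ.≤ h
  r≤ = ∣⊖∣≤ h q (ℕ.s≤s⁻¹ (ℤ.n%ℕd<d (z + + h) M))
  cancelˡ : ∀ r mw → mw ≡ (r + mw) - r
  cancelˡ = solve-∀
  w≤ : ∣ w ∣ ℕ.≤ suc K
  w≤ = ℕ.*-cancelˡ-≤ M $ begin
    M ℕ.* ∣ w ∣         ≡⟨ ℤ.abs-* (+ M) w ⟨
    ∣ + M * w ∣         ≡⟨ cong ∣_∣ (trans (cancelˡ r (+ M * w)) (cong (_- r) (sym z≡))) ⟩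
    ∣ z - r ∣           ≤⟨ ∣-∣≤ z r z≤ (ℕ.≤-trans r≤ (ℕ.≤-trans (ℕ.m≤m+n h (h ℕ.+ 0)) (ℕ.n≤1+n _))) ⟩
    K ℕ.* M ℕ.+ M       ≡⟨ ℕ.+-comm (K ℕ.* M) M ⟩
    suc K ℕ.* M         ≡⟨ ℕ.*-comm (suc K) M ⟩
    M ℕ.* suc K         ∎
    where open ℕ.≤-Reasoning
  -- For z = 0 the shifted number h is smaller than the modulus, so it is its own residue and h - h
  -- remains.
  r≡0 : z ≡ 0ℤ → r ≡ 0ℤ
  r≡0 refl = trans (cong (λ q → + q - + h) (ℕ.m<n⇒m%n≡m (s≤s (ℕ.m≤m+n h (h ℕ.+ 0))))) (ℤ.+-inverseʳ (+ h))

-- The lines, their relations and elimination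

module _ (D m : ℤ) where

  -- The j-th entry is mʲ Dᵏ⁻¹⁻ʲ, so that m times an entry is D times the next one.
  basis : ∀ k → Fin k → ℤ
  basis (suc k) zero    = D ^ k
  basis (suc k) (suc j) = m * basis k j

  ∙-basis-suc : ∀ k (y : Fin (suc k) → ℤ) →
                y ∙ basis (suc k) ≡ y zero * D ^ k + m * (y ∘ suc) ∙ basis k
  ∙-basis-suc k y = cong (λ s → y zero * D ^ k + s) (trans (sum-cong-≗ λ j → swap (y (suc j)) m (basis k j))
                                       (sym (*-distribˡ-sum m (λ j → y (suc j) * basis k j))))
    where
    swap : ∀ y m b → y * (m * b) ≡ m * (y * b)
    swap = solve-∀

  -- The last entry of w is dropped: in carry it is absorbed into the multiple of mᵏ.
  push : ∀ {k} → ℤ → (Fin k → ℤ) → Fin k → ℤ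
  push c w zero    = c
  push c w (suc j) = push (w zero) (w ∘ suc) j

  push-bound : ∀ {k B} c (w : Fin k → ℤ) → ∣ c ∣ ℕ.≤ B → (∀ j → ∣ w j ∣ ℕ.≤ B) →
                ∀ j → ∣ push c w j ∣ ℕ.≤ B
  push-bound c w c≤ w≤ zero    = c≤
  push-bound c w c≤ w≤ (suc j) = push-bound (w zero) (w ∘ suc) (w≤ zero) (w≤ ∘ suc) j

  -- Multiplication by m moves each coefficient one place up and leaves a factor D; what leaves the
  -- last place is a multiple of m^k. The incoming carry `c` is there for the induction.
  carry : ∀ k c (w : Fin k → ℤ) →
          ∃ λ R → D ^ k * c + m * w ∙ basis k ≡ D * push c w ∙ basis k + m ^ k * R
  carry zero c w = c , ring c D m
    where
    ring : ∀ c D m → 1ℤ * c + m * 0ℤ ≡ D * 0ℤ + 1ℤ * c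
    ring = solve-∀
  carry (suc k) c w with carry k (w zero) (w ∘ suc)
  ... | R , eq = R , (begin
    D ^ suc k * c + m * w ∙ basis (suc k)
      ≡⟨ cong (λ s → D ^ suc k * c + m * s) (∙-basis-suc k w) ⟩
    D * D ^ k * c + m * (w zero * D ^ k + m * W)
      ≡⟨ ring₁ D (D ^ k) c m (w zero) W ⟩
    D * (c * D ^ k) + m * (D ^ k * w zero + m * W)
      ≡⟨ cong (λ s → D * (c * D ^ k) + m * s) eq ⟩
    D * (c * D ^ k) + m * (D * V + m ^ k * R)
      ≡⟨ ring₂ D (D ^ k) c m V (m ^ k) R ⟩
    D * (c * D ^ k + m * V) + m * m ^ k * R
      ≡⟨ cong (λ s → D * s + m ^ suc k * R) (∙-basis-suc k (push c w)) ⟨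
    D * push c w ∙ basis (suc k) + m ^ suc k * R ∎)
    where
    open ≡-Reasoning
    W = (w ∘ suc) ∙ basis k
    V = push (w zero) (w ∘ suc) ∙ basis k
    ring₁ : ∀ D Dk c m w0 W → D * Dk * c + m * (w0 * Dk + m * W) ≡ D * (c * Dk) + m * (Dk * w0 + m * W)
    ring₁ = solve-∀
    ring₂ : ∀ D Dk c m V mk R → D * (c * Dk) + m * (D * V + mk * R) ≡ D * (c * Dk + m * V) + m * mk * R
    ring₂ = solve-∀

  -- The first two lines are determined by the others through Σ gᵢ = 0 and Σ i gᵢ = 0.
  line : ∀ k → Fin (suc (suc k)) → ℤ
  line k zero          = (λ j → 1ℤ + κ j) ∙ basis k
  line k (suc zero)    = - (λ j → + 2 + κ j) ∙ basis k
  line k (suc (suc j)) = basis k j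

  coordinates : ∀ {k} → (Fin (suc (suc k)) → ℤ) → Fin k → ℤ
  coordinates x j = x (suc (suc j)) + ((1ℤ + κ j) * x zero - (+ 2 + κ j) * x (suc zero))

  ∙-line : ∀ k x → x ∙ line k ≡ coordinates x ∙ basis k
  ∙-line k x = begin
    x₀ * A + (x₁ * - B + X)                              ≡⟨ ring x₀ x₁ A B X ⟩
    1ℤ * X + 1ℤ * (x₀ * A + (- x₁) * B)                  ≡⟨ cong (λ s → 1ℤ * X + 1ℤ * s) (∙-linear x₀ (- x₁) (λ j → 1ℤ + κ j) (λ j → + 2 + κ j) (basis k)) ⟨
    1ℤ * X + 1ℤ * (λ j → x₀ * (1ℤ + κ j) + - x₁ * (+ 2 + κ j)) ∙ basis k
                                                         ≡⟨ ∙-linear 1ℤ 1ℤ (λ j → x (suc (suc j))) (λ j → x₀ * (1ℤ + κ j) + - x₁ * (+ 2 + κ j)) (basis k) ⟨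
    (λ j → 1ℤ * x (suc (suc j)) + 1ℤ * (x₀ * (1ℤ + κ j) + - x₁ * (+ 2 + κ j))) ∙ basis k
                                                         ≡⟨ ∙-cong (basis k) (λ j → ring′ (x (suc (suc j))) x₀ x₁ (κ j)) ⟩
    coordinates x ∙ basis k                              ∎
    where
    open ≡-Reasoning
    x₀ = x zero
    x₁ = x (suc zero)
    A = (λ j → 1ℤ + κ j) ∙ basis k
    B = (λ j → + 2 + κ j) ∙ basis k
    X = (λ j → x (suc (suc j))) ∙ basis k
    ring : ∀ x₀ x₁ A B X → x₀ * A + (x₁ * - B + X) ≡ 1ℤ * X + 1ℤ * (x₀ * A + (- x₁) * B)
    ring = solve-∀
    ring′ : ∀ y x₀ x₁ κ → 1ℤ * y + 1ℤ * (x₀ * (1ℤ + κ) + - x₁ * (+ 2 + κ)) ≡ y + ((1ℤ + κ) * x₀ - (+ 2 + κ) * x₁)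
    ring′ = solve-∀

  -- Both relations in one: Σ i gᵢ - c Σ gᵢ. In basis coordinates the j-th coefficient is (2+j-c) -
  -- (1+j)c - (2+j)(1-c) = 0.
  line-relation : ∀ k c → (λ i → κ i - c) ∙ line k ≡ 0ℤ
  line-relation k c = trans (∙-line k (λ i → κ i - c)) $
    trans (sum-cong-≗ λ j → ring c (κ j) (basis k j)) (sum-replicate-zero k)
    where
    ring : ∀ c κ b → (+ 2 + κ - c + ((1ℤ + κ) * (0ℤ - c) - (+ 2 + κ) * (1ℤ - c))) * b ≡ 0ℤ
    ring = solve-∀

  -- Subtracting multiples of the relations Σ (i − b) gᵢ = 0 = Σ (i − a) gᵢ clears the
  -- coefficients at a and b.
  eliminate : ∀ {k} (a b : Fin (suc (suc k))) → ℤ →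
              (Fin (suc (suc k)) → ℤ) → Fin (suc (suc k)) → ℤ
  eliminate a b e x i = D * x i + e * (x b * (κ i - κ a) - x a * (κ i - κ b))

  module _ {k} (a b : Fin (suc (suc k))) (e : ℤ) (e-eq : e * (κ a - κ b) ≡ D)
           (x : Fin (suc (suc k)) → ℤ) where

    private
      v = eliminate a b e x

    -- At a the relation centred at a contributes nothing, and the other one contributes -e(a - b)
    -- times the coefficient, which is -D times it. The index b is symmetric.
    eliminate-a : v a ≡ 0ℤ
    eliminate-a = trans (cong (λ D → D * x a + e * (x b * (κ a - κ a) - x a * (κ a - κ b))) (sym e-eq))
                        (ring e (κ a) (κ b) (x a) (x b))
      where
      ring : ∀ e a b xa xb → e * (a - b) * xa + e * (xb * (a - a) - xa * (a - b)) ≡ 0ℤ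
      ring = solve-∀

    eliminate-b : v b ≡ 0ℤ
    eliminate-b = trans (cong (λ D → D * x b + e * (x b * (κ b - κ a) - x a * (κ b - κ b))) (sym e-eq))
                        (ring e (κ a) (κ b) (x a) (x b))
      where
      ring : ∀ e a b xa xb → e * (a - b) * xb + e * (xb * (b - a) - xa * (b - b)) ≡ 0ℤ
      ring = solve-∀

    eliminate-∙ : v ∙ line k ≡ D * x ∙ line k
    eliminate-∙ = begin
      v ∙ g                                                       ≡⟨ ∙-cong g (λ i → ring D (x i) e (x b) (x a) (κ i - κ a) (κ i - κ b)) ⟩
      (λ i → D * x i + 1ℤ * (e * x b * (κ i - κ a) + - (e * x a) * (κ i - κ b))) ∙ g
                                                                  ≡⟨ ∙-linear D 1ℤ x (λ i → e * x b * (κ i - κ a) + - (e * x a) * (κ i - κ b)) g ⟩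
      D * x ∙ g + 1ℤ * (λ i → e * x b * (κ i - κ a) + - (e * x a) * (κ i - κ b)) ∙ g
                                                                  ≡⟨ cong (λ s → D * x ∙ g + 1ℤ * s) (∙-linear (e * x b) (- (e * x a)) (λ i → κ i - κ a) (λ i → κ i - κ b) g) ⟩
      D * x ∙ g + 1ℤ * (e * x b * (λ i → κ i - κ a) ∙ g + - (e * x a) * (λ i → κ i - κ b) ∙ g)
                                                                  ≡⟨ cong₂ (λ s t → D * x ∙ g + 1ℤ * (e * x b * s + - (e * x a) * t)) (line-relation k (κ a)) (line-relation k (κ b)) ⟩
      D * x ∙ g + 1ℤ * (e * x b * 0ℤ + - (e * x a) * 0ℤ)         ≡⟨ ring′ (D * x ∙ g) (e * x b) (- (e * x a)) ⟩
      D * x ∙ g                                                   ∎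
      where
      open ≡-Reasoning
      g = line k
      ring : ∀ D xi e xb xa p q → D * xi + e * (xb * p - xa * q) ≡ D * xi + 1ℤ * (e * xb * p + - (e * xa) * q)
      ring = solve-∀
      ring′ : ∀ s p q → s + 1ℤ * (p * 0ℤ + q * 0ℤ) ≡ s
      ring′ = solve-∀

    -- Only d, `B` and k enter the bound, so bounded coefficients stay bounded however large m is.
    eliminate-bound : ∀ {d B} → ∣ D ∣ ℕ.≤ d → ∣ e ∣ ℕ.≤ d → (∀ i → ∣ x i ∣ ℕ.≤ B) →
                      ∀ i → ∣ v i ∣ ℕ.≤ d ℕ.* B ℕ.+ d ℕ.* (B ℕ.* suc (suc k) ℕ.+ B ℕ.* suc (suc k))
    eliminate-bound D≤ e≤ x≤ i =
      ∣+∣≤ (D * x i) _ (∣*∣≤ D (x i) D≤ (x≤ i))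
        (∣*∣≤ e _ e≤ (∣-∣≤ (x b * (κ i - κ a)) (x a * (κ i - κ b))
          (∣*∣≤ (x b) _ (x≤ b) (∣κ-κ∣≤ i a)) (∣*∣≤ (x a) _ (x≤ a) (∣κ-κ∣≤ i b))))

  onBasis : ∀ {k} → (Fin k → ℤ) → Fin (suc (suc k)) → ℤ
  onBasis y zero          = 0ℤ
  onBasis y (suc zero)    = 0ℤ
  onBasis y (suc (suc j)) = y j

  onBasis-bound : ∀ {k B} (y : Fin k → ℤ) → (∀ j → ∣ y j ∣ ℕ.≤ B) → ∀ i → ∣ onBasis y i ∣ ℕ.≤ B
  onBasis-bound y y≤ zero          = z≤n
  onBasis-bound y y≤ (suc zero)    = z≤n
  onBasis-bound y y≤ (suc (suc j)) = y≤ j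

  onBasis-∙ : ∀ k y → onBasis y ∙ line k ≡ y ∙ basis k
  onBasis-∙ k y = trans (∙-line k (onBasis y)) (∙-cong (basis k) λ j → ring (y j) (κ j))
    where
    ring : ∀ y κ → y + ((1ℤ + κ) * 0ℤ - (+ 2 + κ) * 0ℤ) ≡ y
    ring = solve-∀

∙-omit : ∀ {k} (a : Fin (suc (suc k))) (b : Fin (suc k)) (x g : Fin (suc (suc k)) → ℤ) →
         x a ≡ 0ℤ → x (punchIn a b) ≡ 0ℤ →
         x ∙ g ≡ (λ l → x (punchIn a (punchIn b l))) ∙ (λ l → g (punchIn a (punchIn b l)))
∙-omit a b x g xa≡0 xb≡0 = begin
  x ∙ g                                                   ≡⟨ sum-remove {i = a} (λ i → x i * g i) ⟩
  x a * g a + sum (λ i → x (punchIn a i) * g (punchIn a i)) ≡⟨ cong (λ s → x a * g a + s) (sum-remove {i = b} (λ i → x (punchIn a i) * g (punchIn a i))) ⟩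
  x a * g a + (x (punchIn a b) * g (punchIn a b) + S)     ≡⟨ cong₂ (λ s t → s * g a + (t * g (punchIn a b) + S)) xa≡0 xb≡0 ⟩
  0ℤ * g a + (0ℤ * g (punchIn a b) + S)                   ≡⟨ ring (g a) (g (punchIn a b)) S ⟩
  S                                                       ∎
  where
  open ≡-Reasoning
  S = (λ l → x (punchIn a (punchIn b l))) ∙ (λ l → g (punchIn a (punchIn b l)))
  ring : ∀ p q s → 0ℤ * p + (0ℤ * q + s) ≡ s
  ring = solve-∀

-- Expansion to base M with weights that contain powers of D

module _ (D : ℤ) (M : ℕ) .{{_ : ℕ.NonZero M}} (D⁻¹ c : ℤ) (inverse : D * D⁻¹ ≡ 1ℤ + + M * c) where

  power-inverse : ∀ k → ∃ λ r → D ^ k * D⁻¹ ^ k ≡ 1ℤ + + M * r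
  power-inverse zero = 0ℤ , ring (+ M)
    where
    ring : ∀ m → 1ℤ * 1ℤ ≡ 1ℤ + m * 0ℤ
    ring = solve-∀
  power-inverse (suc k) with power-inverse k
  ... | r , eq = c + r + + M * c * r ,
        trans (ring₁ D D⁻¹ (D ^ k) (D⁻¹ ^ k)) (trans (cong₂ _*_ inverse eq) (ring₂ (+ M) c r))
    where
    ring₁ : ∀ D E Dk Ek → D * Dk * (E * Ek) ≡ D * E * (Dk * Ek)
    ring₁ = solve-∀
    ring₂ : ∀ m c r → (1ℤ + m * c) * (1ℤ + m * r) ≡ 1ℤ + m * (c + r + m * c * r)
    ring₂ = solve-∀

  -- D^k is a unit modulo M, so the digit is the residue of Q times its inverse.
  lowest-digit : ∀ k Q → ∃ λ y → ∃ λ R → Q ≡ D ^ k * y + + M * R × ∣ y ∣ ℕ.≤ M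
  lowest-digit k Q with power-inverse k
  ... | r , eq = + y , Dᵏ * p - r * Q , Q≡ , ℕ.<⇒≤ (ℤ.n%ℕd<d (Q * Eᵏ) M)
    where
    Dᵏ = D ^ k
    Eᵏ = D⁻¹ ^ k
    y = (Q * Eᵏ) ℤ.%ℕ M
    p = (Q * Eᵏ) ℤ./ℕ M
    ring₁ : ∀ Q D E m r → D * E ≡ 1ℤ + m * r → Q ≡ D * (Q * E) - m * (r * Q)
    ring₁ Q D E m r eq = trans (solve₁ Q m r) (trans (cong (λ s → s * Q - m * (r * Q)) (sym eq)) (solve₂ Q D E m r))
      where
      solve₁ : ∀ Q m r → Q ≡ (1ℤ + m * r) * Q - m * (r * Q)
      solve₁ = solve-∀
      solve₂ : ∀ Q D E m r → D * E * Q - m * (r * Q) ≡ D * (Q * E) - m * (r * Q)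
      solve₂ = solve-∀
    ring₂ : ∀ D y m p s → D * (y + m * p) - m * s ≡ D * y + m * (D * p - s)
    ring₂ = solve-∀
    Q≡ : Q ≡ Dᵏ * + y + + M * (Dᵏ * p - r * Q)
    Q≡ = trans (ring₁ Q Dᵏ Eᵏ (+ M) r eq)
         (trans (cong (λ s → Dᵏ * s - + M * (r * Q)) (divℕ (Q * Eᵏ) M))
                (ring₂ Dᵏ (+ y) (+ M) p (r * Q)))

  -- The weight of the j-th digit is M^j times a power of D, which is a unit modulo M, so the digits
  -- can be split off one after the other as in an ordinary expansion. The outer factor D prepares
  -- the first elimination.
  digits : ∀ k Q → ∃ λ y → ∃ λ R → Q ≡ D * y ∙ basis D (+ M) k + (+ M) ^ k * R × (∀ j → ∣ y j ∣ ℕ.≤ M)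
  digits zero Q = (λ ()) , Q , ring D Q , λ ()
    where
    ring : ∀ D Q → Q ≡ D * 0ℤ + 1ℤ * Q
    ring = solve-∀
  digits (suc k) Q = y′ , R , eq , λ { zero → proj₂ (proj₂ (proj₂ low)) ; (suc j) → proj₂ (proj₂ (proj₂ high)) j }
    where
    open ≡-Reasoning
    m = + M
    -- The exponent is k+1: the first basis entry D^k together with the outer factor D.
    low = lowest-digit (suc k) Q
    y₀ = proj₁ low
    Q₁ = proj₁ (proj₂ low)
    high = digits k Q₁
    y = proj₁ high
    R = proj₁ (proj₂ high)
    y′ : Fin (suc k) → ℤ
    y′ zero    = y₀
    y′ (suc j) = y j
    Y = y ∙ basis D m k
    ring : ∀ D Dk y₀ m Y mk R → D * Dk * y₀ + m * (D * Y + mk * R) ≡ D * (y₀ * Dk + m * Y) + m * mk * R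
    ring = solve-∀
    eq : Q ≡ D * y′ ∙ basis D m (suc k) + m ^ suc k * R
    eq = begin
      Q                                                       ≡⟨ proj₁ (proj₂ (proj₂ low)) ⟩
      D * D ^ k * y₀ + m * Q₁                                 ≡⟨ cong (λ s → D * D ^ k * y₀ + m * s) (proj₁ (proj₂ (proj₂ high))) ⟩
      D * D ^ k * y₀ + m * (D * Y + m ^ k * R)                ≡⟨ ring D (D ^ k) y₀ m Y (m ^ k) R ⟩
      D * (y₀ * D ^ k + m * Y) + m * m ^ k * R                ≡⟨ cong (λ s → D * s + m ^ suc k * R) (∙-basis-suc D m k y′) ⟨
      D * y′ ∙ basis D m (suc k) + m ^ suc k * R              ∎

-- The bound on the coefficients produced by eliminate from coefficients bounded by B.
blowup : ℕ → ℕ → ℕ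
blowup k B = suc k ! ℕ.* B ℕ.+ suc k ! ℕ.* (B ℕ.* suc (suc k) ℕ.+ B ℕ.* suc (suc k))

-- `W` bounds the quotients left by the reduction modulo M, the argument of `blowup` bounds their
-- basis coordinates, and `blowup` accounts for the second elimination. The result does not depend
-- on M.
slack : ℕ → ℕ
slack k = blowup k (W ℕ.+ (suc (suc k) ℕ.* W ℕ.+ suc (suc k) ℕ.* W))
  where
  W : ℕ
  W = suc (blowup k 1)

-- Representing every residue modulo M^k by k of the lines

module Cover (k s : ℕ) where

  D : ℤ
  D = + (suc k !)
  h M : ℕ
  h = s ℕ.* suc k !
  M = suc (2 ℕ.* h)
  lines : Fin (suc (suc k)) → ℤ
  lines = line D (+ M) k

  private
    -- M = 1 + 2sD, hence -2sD = 1 - M.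
    D-inverse : D * - (+ 2 * + s) ≡ 1ℤ + + M * - 1ℤ
    D-inverse = trans (ring D (+ s)) (cong (λ t → 1ℤ + t * - 1ℤ) {1ℤ + + 2 * (+ s * D)} {+ M} (sym M≡))
      where
      ring : ∀ D s → D * - (+ 2 * s) ≡ 1ℤ + (1ℤ + + 2 * (s * D)) * - 1ℤ
      ring = solve-∀
      M≡ : + M ≡ 1ℤ + + 2 * (+ s * + (suc k !))
      M≡ = cong (λ t → 1ℤ + t) (trans (ℤ.pos-* 2 h) (cong (λ t → + 2 * t) (ℤ.pos-* s (suc k !))))

    -- Linearity in `B` puts the bound of the first elimination into the form K · M that `balanced`
    -- asks for.
    blowup-* : ∀ B → blowup k B ≡ blowup k 1 ℕ.* B
    blowup-* B = ring (suc k !) B (suc (suc k))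
      where
      ring : ∀ d B f → d ℕ.* B ℕ.+ d ℕ.* (B ℕ.* f ℕ.+ B ℕ.* f) ≡ (d ℕ.* 1 ℕ.+ d ℕ.* (1 ℕ.* f ℕ.+ 1 ℕ.* f)) ℕ.* B
      ring = solve-∀ℕ

  -- The coefficients are first brought into [-h, h]; the multiples of M removed from them return as a
  -- bounded carry.
  cover : ∀ (a : Fin (suc (suc k))) (b : Fin (suc k)) Q →
          ∃ λ (x : Fin k → ℤ) → ∃ λ R →
            Q ≡ x ∙ (λ l → lines (punchIn a (punchIn b l))) + (+ M) ^ k * R ×
            (∀ l → ∣ x l ∣ ℕ.≤ h ℕ.+ slack k)
  cover a b Q
    with e , e-eq , e≤ ← differences-divide a (punchIn a b) (Fin.punchInᵢ≢i a b ∘ sym)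
       | y , R , Q≡ , y≤ ← digits D M (- (+ 2 * + s)) (- 1ℤ) D-inverse k Q
    = (λ l → x (punchIn a (punchIn b l))) , R′ + R , eq , λ l → x≤ (punchIn a (punchIn b l))
    where
    m = + M
    a′ = punchIn a b
    u = onBasis D m y
    v = eliminate D m a a′ e u
    v≤ : ∀ i → ∣ v i ∣ ℕ.≤ blowup k 1 ℕ.* M
    v≤ i = subst (∣ v i ∣ ℕ.≤_) (blowup-* M)
             (eliminate-bound D m a a′ e e-eq u ℕ.≤-refl e≤ (onBasis-bound D m y y≤) i)
    reduced : ∀ i → ∃ λ r → ∃ λ w → v i ≡ r + m * w × ∣ r ∣ ℕ.≤ h × ∣ w ∣ ℕ.≤ suc (blowup k 1) × (v i ≡ 0ℤ → r ≡ 0ℤ)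
    reduced i = balanced h (blowup k 1) (v i) (v≤ i)
    r w : Fin (suc (suc k)) → ℤ
    r i = proj₁ (reduced i)
    w i = proj₁ (proj₂ (reduced i))
    w≤ : ∀ i → ∣ w i ∣ ℕ.≤ suc (blowup k 1)
    w≤ i = proj₁ (proj₂ (proj₂ (proj₂ (proj₂ (reduced i)))))
    W : ℕ
    W = suc (blowup k 1)
    -- The quotients are indexed by all lines; rewritten on the basis they can be carried.
    w′ = coordinates D m w
    w′≤ : ∀ j → ∣ w′ j ∣ ℕ.≤ W ℕ.+ (suc (suc k) ℕ.* W ℕ.+ suc (suc k) ℕ.* W)
    w′≤ j = ∣+∣≤ (w (suc (suc j))) _ (w≤ (suc (suc j)))
              (∣-∣≤ ((1ℤ + κ j) * w zero) ((+ 2 + κ j) * w (suc zero))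
                (∣*∣≤ (1ℤ + κ j) (w zero) (s≤s (ℕ.<⇒≤ (ℕ.≤-trans (Fin.toℕ<n j) (ℕ.n≤1+n k)))) (w≤ zero))
                (∣*∣≤ (+ 2 + κ j) (w (suc zero)) (s≤s (s≤s (ℕ.<⇒≤ (Fin.toℕ<n j)))) (w≤ (suc zero))))
    -- `carry` has produced D times this combination, which is what eliminating the same two lines
    -- again requires.
    u₂ = onBasis D m (push D m 0ℤ w′)
    v₂ = eliminate D m a a′ e u₂
    v₂≤ : ∀ i → ∣ v₂ i ∣ ℕ.≤ slack k
    v₂≤ = eliminate-bound D m a a′ e e-eq u₂ ℕ.≤-refl e≤
            (onBasis-bound D m (push D m 0ℤ w′) (push-bound D m 0ℤ w′ z≤n w′≤))
    x = λ i → r i + v₂ i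
    x≤ : ∀ i → ∣ x i ∣ ℕ.≤ h ℕ.+ slack k
    x≤ i = ∣+∣≤ (r i) (v₂ i) (proj₁ (proj₂ (proj₂ (proj₂ (reduced i))))) (v₂≤ i)
    x≡0 : ∀ i → v i ≡ 0ℤ → v₂ i ≡ 0ℤ → x i ≡ 0ℤ
    x≡0 i p q = cong₂ _+_ (proj₂ (proj₂ (proj₂ (proj₂ (proj₂ (reduced i))))) p) q
    carried = carry D m k 0ℤ w′
    R′ = proj₁ carried
    open ≡-Reasoning
    ring₁ : ∀ r m w → r + m * w ≡ 1ℤ * r + m * w
    ring₁ = solve-∀
    ring₂ : ∀ r D s mk R′ R → 1ℤ * r + (D * s + mk * R′) + mk * R ≡ 1ℤ * r + 1ℤ * (D * s) + mk * (R′ + R)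
    ring₂ = solve-∀
    ring₃ : ∀ Dk s → s ≡ Dk * 0ℤ + s
    ring₃ = solve-∀
    ring₄ : ∀ r v → 1ℤ * r + 1ℤ * v ≡ r + v
    ring₄ = solve-∀
    eq : Q ≡ (λ l → x (punchIn a (punchIn b l))) ∙ (λ l → lines (punchIn a (punchIn b l))) + m ^ k * (R′ + R)
    eq = begin
      Q
        ≡⟨ Q≡ ⟩
      D * y ∙ basis D m k + m ^ k * R
        ≡⟨ cong (λ s → D * s + m ^ k * R) (onBasis-∙ D m k y) ⟨
      D * u ∙ lines + m ^ k * R
        ≡⟨ cong (λ s → s + m ^ k * R) (eliminate-∙ D m a a′ e e-eq u) ⟨
      v ∙ lines + m ^ k * R
        ≡⟨ cong (λ s → s + m ^ k * R) (∙-cong lines λ i → trans (proj₁ (proj₂ (proj₂ (reduced i)))) (ring₁ (r i) m (w i))) ⟩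
      (λ i → 1ℤ * r i + m * w i) ∙ lines + m ^ k * R
        ≡⟨ cong (λ s → s + m ^ k * R) (∙-linear 1ℤ m r w lines) ⟩
      1ℤ * r ∙ lines + m * w ∙ lines + m ^ k * R
        ≡⟨ cong (λ s → 1ℤ * r ∙ lines + m * s + m ^ k * R) (∙-line D m k w) ⟩
      1ℤ * r ∙ lines + m * w′ ∙ basis D m k + m ^ k * R
        ≡⟨ cong (λ s → 1ℤ * r ∙ lines + s + m ^ k * R) (trans (ring₃ (D ^ k) _) (proj₂ carried)) ⟩
      1ℤ * r ∙ lines + (D * push D m 0ℤ w′ ∙ basis D m k + m ^ k * R′) + m ^ k * R
        ≡⟨ ring₂ (r ∙ lines) D (push D m 0ℤ w′ ∙ basis D m k) (m ^ k) R′ R ⟩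
      1ℤ * r ∙ lines + 1ℤ * (D * push D m 0ℤ w′ ∙ basis D m k) + m ^ k * (R′ + R)
        ≡⟨ cong (λ s → 1ℤ * r ∙ lines + 1ℤ * (D * s) + m ^ k * (R′ + R)) (onBasis-∙ D m k (push D m 0ℤ w′)) ⟨
      1ℤ * r ∙ lines + 1ℤ * (D * u₂ ∙ lines) + m ^ k * (R′ + R)
        ≡⟨ cong (λ s → 1ℤ * r ∙ lines + 1ℤ * s + m ^ k * (R′ + R)) (eliminate-∙ D m a a′ e e-eq u₂) ⟨
      1ℤ * r ∙ lines + 1ℤ * v₂ ∙ lines + m ^ k * (R′ + R)
        ≡⟨ cong (λ s → s + m ^ k * (R′ + R)) (∙-linear 1ℤ 1ℤ r v₂ lines) ⟨
      (λ i → 1ℤ * r i + 1ℤ * v₂ i) ∙ lines + m ^ k * (R′ + R)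
        ≡⟨ cong (λ s → s + m ^ k * (R′ + R)) (∙-cong lines λ i → ring₄ (r i) (v₂ i)) ⟩
      x ∙ lines + m ^ k * (R′ + R)
        ≡⟨ cong (λ s → s + m ^ k * (R′ + R)) (∙-omit a b x lines
             (x≡0 a (eliminate-a D m a a′ e e-eq u) (eliminate-a D m a a′ e e-eq u₂))
             (x≡0 a′ (eliminate-b D m a a′ e e-eq u) (eliminate-b D m a a′ e e-eq u₂))) ⟩
      (λ l → x (punchIn a (punchIn b l))) ∙ (λ l → lines (punchIn a (punchIn b l))) + m ^ k * (R′ + R) ∎

-- Symmetric connection sets of prescribed size

Unique-⊆-length : ∀ {xs ys : List ℕ} → Unique xs → xs ⊆ ys → length xs ℕ.≤ length ys
Unique-⊆-length {[]} _ _ = z≤n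
Unique-⊆-length {x ∷ xs} {ys} (x∉ ∷ xs!) xs⊆ys
  with us , vs , refl ← ∈-∃++ (xs⊆ys (here refl)) = begin
    suc (length xs)               ≤⟨ s≤s (Unique-⊆-length xs! (⊆∷∧∉⇒⊆ (⊆-respʳ-↭ (shift x us vs) (xs⊆ys ∘ there)) (λ x∈ → All.lookup x∉ x∈ refl))) ⟩
    suc (length (us ++ vs))       ≡⟨ ↭-length (shift x us vs) ⟨
    length (us ++ [ x ] ++ vs)    ∎
    where open ℕ.≤-Reasoning

Unique-map : ∀ {P : ℕ → Set} {f : ℕ → ℕ} → (∀ {x y} → P x → P y → f x ≡ f y → x ≡ y) →
             ∀ {xs} → All P xs → Unique xs → Unique (map f xs)
Unique-map inj []         []          = []
Unique-map inj (px ∷ pxs) (x∉ ∷ xs!) =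
  All.map⁺ (All.zipWith (λ (py , x≢y) eq → x≢y (inj px py eq)) (pxs , x∉)) ∷ Unique-map inj pxs xs!

-- The smaller member of a pair {s, n - s} of two different nonzero elements.
Half : ℕ → ℕ → Set
Half n s = 0 ℕ.< s × s ℕ.+ s ℕ.< n

-- The degree has to be met exactly. Among 1, ..., h at least h - |U| numbers lie outside U, and h +
-- h < n keeps all of them in the lower half.
extend : ∀ {n h} (H₀ : List ℕ) → All (Half n) H₀ → length H₀ ℕ.≤ h → h ℕ.+ h ℕ.< n →
         ∃ λ H → Unique H × All (Half n) H × H₀ ⊆ H × length H ≡ h
extend {n} {h} H₀ half ≤h 2h<n = H , H! , H-half , ∈-++⁺ˡ ∘ ∈-deduplicate⁺ ℕ._≟_ , H-length
  where
  U = deduplicate ℕ._≟_ H₀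
  range = map suc (upTo h)
  F = filter (¬? ∘ (_∈? U)) range
  H = U ++ take (h ℕ.∸ length U) F
  U≤h : length U ℕ.≤ h
  U≤h = ℕ.≤-trans (length-deduplicate ℕ._≟_ H₀) ≤h
  take⊆ : ∀ n (xs : List ℕ) → take n xs ⊆ xs
  take⊆ (suc n) (x ∷ xs) (here p)  = here p
  take⊆ (suc n) (x ∷ xs) (there p) = there (take⊆ n xs p)
  range! : Unique range
  range! = Unique.map⁺ ℕ.suc-injective (Unique.upTo⁺ h)
  H! : Unique H
  H! = Unique.++⁺ (deduplicate-! H₀) (Unique.take⁺ (h ℕ.∸ length U) (Unique.filter⁺ (¬? ∘ (_∈? U)) range!))
         λ (∈U , ∈F) → proj₂ (∈-filter⁻ (¬? ∘ (_∈? U)) {xs = range} (take⊆ _ F ∈F)) ∈U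
  half-range : ∀ {s} → s ∈ range → Half n s
  half-range s∈ with i , i∈ , refl ← ∈-map⁻ suc s∈ =
    s≤s z≤n , ℕ.≤-<-trans (ℕ.+-mono-≤ (∈-upTo⁻ i∈) (∈-upTo⁻ i∈)) 2h<n
  H-half : All (Half n) H
  H-half = All.++⁺ (All.deduplicate⁺ ℕ._≟_ half)
    (All.tabulate λ s∈ → half-range (proj₁ (∈-filter⁻ (¬? ∘ (_∈? U)) {xs = range} (take⊆ _ F s∈))))
  range⊆ : range ⊆ U ++ F
  range⊆ {s} s∈ with s ∈? U
  ... | yes s∈U = ∈-++⁺ˡ s∈U
  ... | no  s∉U = ∈-++⁺ʳ U (∈-filter⁺ (¬? ∘ (_∈? U)) s∈ s∉U)
  enough : h ℕ.∸ length U ℕ.≤ length F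
  enough = ℕ.m≤n+o⇒m∸n≤o h (length U) $ begin
    h                        ≡⟨ trans (length-map suc (upTo h)) (length-upTo h) ⟨
    length range             ≤⟨ Unique-⊆-length range! range⊆ ⟩
    length (U ++ F)          ≡⟨ length-++ U ⟩
    length U ℕ.+ length F    ∎
    where open ℕ.≤-Reasoning
  H-length : length H ≡ h
  H-length = begin
    length H                                      ≡⟨ length-++ U ⟩
    length U ℕ.+ length (take (h ℕ.∸ length U) F) ≡⟨ cong (length U ℕ.+_) (length-take (h ℕ.∸ length U) F) ⟩
    length U ℕ.+ (h ℕ.∸ length U) ℕ.⊓ length F    ≡⟨ cong (length U ℕ.+_) (ℕ.m≤n⇒m⊓n≡m enough) ⟩
    length U ℕ.+ (h ℕ.∸ length U)                 ≡⟨ ℕ.m+[n∸m]≡n U≤h ⟩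
    h                                             ∎
    where open ≡-Reasoning

Walk : List ℕ → ℕ → ℕ → ℕ → Set
Walk S k n x = Σ (List ℕ) λ ws → length ws ℕ.≤ k × All (_∈ S) ws ×
                 ∃ λ q → sumℕ ws ≡ x ℕ.+ q ℕ.* n

-- In a graph of odd degree, mid is the singleton of the involution n / 2.
symmetrize : ∀ {k n h} (mid H₀ : List ℕ) →
             0 ℕ.< n → All (λ s → s ℕ.+ s ≡ n) mid → Unique mid →
             All (Half n) H₀ → length H₀ ℕ.≤ h → h ℕ.+ h ℕ.< n →
             (∀ S → (∀ {s} → s ∈ H₀ → s ∈ S × n ℕ.∸ s ∈ S) → ∀ x → x ℕ.< n → Walk S k n x) →
             Circulant (h ℕ.+ (h ℕ.+ length mid)) k n
symmetrize {k} {n} {h} mid H₀ 0<n mid≡ mid! half ≤h 2h<n walk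
  with H , H! , H-half , H₀⊆H , refl ← extend H₀ half ≤h 2h<n = record
  { S      = S
  ; range  = All.++⁺ (All.map (λ {s} (0<s , s+s<n) → 0<s , ℕ.≤-<-trans (ℕ.m≤m+n s s) s+s<n) H-half)
              (All.++⁺ (All.map⁺ (All.map (λ {s} (0<s , s+s<n) → ℕ.m<n⇒0<n∸m (ℕ.≤-<-trans (ℕ.m≤m+n s s) s+s<n) , n∸s<n 0<s s+s<n) H-half))
                       (All.map mid-range mid≡))
  ; unique = Unique.++⁺ H! (Unique.++⁺ (Unique-map ∸-injective H-half H!) mid! far#mid) near#rest
  ; symm   = All.++⁺ (All.tabulate (λ s∈ → far⊆S (∈-map⁺ (n ℕ.∸_) s∈)))
              (All.++⁺ (All.map⁺ (All.tabulate (λ {s} s∈ → subst (_∈ S) (sym (ℕ.m∸[m∸n]≡n (s≤n s∈))) (∈-++⁺ˡ s∈))))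
                       (All.tabulate (λ {s} s∈ → subst (_∈ S) (mid-fixed (All.lookup mid≡ s∈)) (mid⊆S s∈))))
  ; degree = trans (length-++ H) (cong (length H ℕ.+_)
              (trans (length-++ (map (n ℕ.∸_) H)) (cong (ℕ._+ length mid) (length-map (n ℕ.∸_) H))))
  ; diam   = walk S λ s∈ → ∈-++⁺ˡ (H₀⊆H s∈) , far⊆S (∈-map⁺ (n ℕ.∸_) (H₀⊆H s∈))
  }
  where
  -- The three blocks lie strictly below, strictly above and exactly at n / 2, hence they are
  -- disjoint.
  S = H ++ (map (n ℕ.∸_) H ++ mid)
  far⊆S : ∀ {s} → s ∈ map (n ℕ.∸_) H → s ∈ S
  far⊆S s∈ = ∈-++⁺ʳ H (∈-++⁺ˡ s∈)
  mid⊆S : ∀ {s} → s ∈ mid → s ∈ S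
  mid⊆S s∈ = ∈-++⁺ʳ H (∈-++⁺ʳ (map (n ℕ.∸_) H) s∈)
  s≤n : ∀ {s} → s ∈ H → s ℕ.≤ n
  s≤n {s} s∈ = ℕ.<⇒≤ (ℕ.≤-<-trans (ℕ.m≤m+n s s) (proj₂ (All.lookup H-half s∈)))
  n∸s<n : ∀ {s} → 0 ℕ.< s → s ℕ.+ s ℕ.< n → n ℕ.∸ s ℕ.< n
  n∸s<n {s} 0<s s+s<n = ℕ.∸-monoʳ-< {n} {s} {0} 0<s (ℕ.<⇒≤ (ℕ.≤-<-trans (ℕ.m≤m+n s s) s+s<n))
  mid-range : ∀ {s} → s ℕ.+ s ≡ n → 0 ℕ.< s × s ℕ.< n
  mid-range {zero}  refl = contradiction 0<n λ ()
  mid-range {suc s} refl = s≤s z≤n , ℕ.m<m+n (suc s) (s≤s z≤n)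
  mid-fixed : ∀ {s} → s ℕ.+ s ≡ n → s ≡ n ℕ.∸ s
  mid-fixed {s} refl = sym (ℕ.m+n∸n≡m s s)
  ∸-injective : ∀ {s t} → Half n s → Half n t → n ℕ.∸ s ≡ n ℕ.∸ t → s ≡ t
  ∸-injective {s} {t} (_ , s<) (_ , t<) = ℕ.∸-cancelˡ-≡ (ℕ.<⇒≤ (ℕ.≤-<-trans (ℕ.m≤m+n s s) s<)) (ℕ.<⇒≤ (ℕ.≤-<-trans (ℕ.m≤m+n t t) t<))
  far : ∀ {v} → v ∈ map (n ℕ.∸_) H → n ℕ.< v ℕ.+ v
  far v∈ with s , s∈ , refl ← ∈-map⁻ (n ℕ.∸_) v∈ = begin-strict
    n                             ≡⟨ ℕ.m∸n+n≡m (s≤n s∈) ⟨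
    (n ℕ.∸ s) ℕ.+ s               <⟨ ℕ.+-monoʳ-< (n ℕ.∸ s) (ℕ.m+n≤o⇒m≤o∸n (suc s) (proj₂ (All.lookup H-half s∈))) ⟩
    (n ℕ.∸ s) ℕ.+ (n ℕ.∸ s)       ∎
    where open ℕ.≤-Reasoning
  far#mid : ∀ {v} → ¬ (v ∈ map (n ℕ.∸_) H × v ∈ mid)
  far#mid (v∈ , v∈′) = ℕ.<-irrefl (sym (All.lookup mid≡ v∈′)) (far v∈)
  near#rest : ∀ {v} → ¬ (v ∈ H × v ∈ map (n ℕ.∸_) H ++ mid)
  near#rest (v∈ , v∈′) with ∈-++⁻ (map (n ℕ.∸_) H) v∈′
  ... | inj₁ v∈far = ℕ.<-asym (far v∈far) (proj₂ (All.lookup H-half v∈))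
  ... | inj₂ v∈mid = ℕ.<-irrefl (All.lookup mid≡ v∈mid) (proj₂ (All.lookup H-half v∈))

-- Residues up to sign, and walks

module Residues (n : ℕ) .{{_ : ℕ.NonZero n}} where

  -- The representative of the pair ±z modulo n in the range from 0 to n / 2.
  fold : ℤ → ℕ
  fold z with z ℤ.%ℕ n
  ... | r with r ℕ.+ r ℕ.<? n
  ... | yes _ = r
  ... | no  _ = n ℕ.∸ r

  private
    +∸ : ∀ {r} → r ℕ.≤ n → + (n ℕ.∸ r) ≡ + n - + r
    +∸ {r} r≤n = sym (trans (ℤ.[+m]-[+n]≡m⊖n n r) (ℤ.⊖-≥ r≤n))

  fold-≡ : ∀ z → ∃ λ q → z ≡ + fold z + + n * q ⊎ z ≡ - + fold z + + n * q
  fold-≡ z with z ℤ.%ℕ n | divℕ z n | ℤ.n%ℕd<d z n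
  ... | r | eq | r<n with r ℕ.+ r ℕ.<? n
  ... | yes _ = z ℤ./ℕ n , inj₁ eq
  ... | no  _ = z ℤ./ℕ n + 1ℤ , inj₂ (trans eq (trans (ring (+ r) (+ n) (z ℤ./ℕ n))
                  (cong (λ s → - s + + n * (z ℤ./ℕ n + 1ℤ)) (sym (+∸ (ℕ.<⇒≤ r<n))))))
    where
    ring : ∀ r n q → r + n * q ≡ - (n - r) + n * (q + 1ℤ)
    ring = solve-∀

  fold-≤ : ∀ z → fold z ℕ.+ fold z ℕ.≤ n
  fold-≤ z with z ℤ.%ℕ n | ℤ.n%ℕd<d z n
  ... | r | r<n with r ℕ.+ r ℕ.<? n
  ... | yes 2r<n = ℕ.<⇒≤ 2r<n
  ... | no  2r≮n = begin
    (n ℕ.∸ r) ℕ.+ (n ℕ.∸ r)  ≤⟨ ℕ.+-monoʳ-≤ (n ℕ.∸ r) (ℕ.m≤n+o⇒m∸n≤o n r (ℕ.≮⇒≥ 2r≮n)) ⟩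
    (n ℕ.∸ r) ℕ.+ r          ≡⟨ ℕ.m∸n+n≡m (ℕ.<⇒≤ r<n) ⟩
    n                        ∎
    where open ℕ.≤-Reasoning

  -- The two excluded ends 0 and n / 2 are the residues whose double vanishes modulo n.
  fold-half : ∀ z → (∀ q → z + z ≢ + n * q) → Half n (fold z)
  fold-half z 2z≢ = ℕ.n≢0⇒n>0 fold≢0 , ℕ.≤∧≢⇒< (fold-≤ z) 2fold≢n
    where
    ring₁ : ∀ n q → (0ℤ + n * q) + (0ℤ + n * q) ≡ n * (q + q)
    ring₁ = solve-∀
    fold≢0 : fold z ≢ 0
    fold≢0 eq with fold-≡ z
    ... | q , inj₁ z≡ rewrite eq = 2z≢ (q + q) (trans (cong₂ _+_ z≡ z≡) (ring₁ (+ n) q))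
    ... | q , inj₂ z≡ rewrite eq = 2z≢ (q + q) (trans (cong₂ _+_ z≡ z≡) (ring₁ (+ n) q))
    ring₂ : ∀ f n q → (f + n * q) + (f + n * q) ≡ (f + f) + n * (q + q)
    ring₂ = solve-∀
    ring₃ : ∀ f n q → (- f + n * q) + (- f + n * q) ≡ - (f + f) + n * (q + q)
    ring₃ = solve-∀
    ring₄ : ∀ n q → n + n * q ≡ n * (1ℤ + q)
    ring₄ = solve-∀
    ring₅ : ∀ n q → - n + n * q ≡ n * (q - 1ℤ)
    ring₅ = solve-∀
    2fold≢n : fold z ℕ.+ fold z ≢ n
    2fold≢n eq with fold-≡ z
    ... | q , inj₁ z≡ = 2z≢ (1ℤ + (q + q)) (trans (cong₂ _+_ z≡ z≡) (trans (ring₂ (+ fold z) (+ n) q)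
                          (trans (cong (λ s → s + + n * (q + q)) (trans (sym (ℤ.pos-+ (fold z) (fold z))) (cong +_ eq))) (ring₄ (+ n) (q + q)))))
    ... | q , inj₂ z≡ = 2z≢ ((q + q) - 1ℤ) (trans (cong₂ _+_ z≡ z≡) (trans (ring₃ (+ fold z) (+ n) q)
                          (trans (cong (λ s → - s + + n * (q + q)) (trans (sym (ℤ.pos-+ (fold z) (fold z))) (cong +_ eq))) (ring₅ (+ n) (q + q)))))

  Represented : List ℕ → ℤ → Set
  Represented S z = ∃ λ w → w ∈ S × ∃ λ q → z ≡ + w + + n * q

  represented : ∀ {S} z → fold z ∈ S → n ℕ.∸ fold z ∈ S → Represented S z × Represented S (- z)
  represented {S} z s∈ s′∈ with fold-≡ z
  ... | q , inj₁ z≡ = (fold z , s∈ , q , z≡)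
                    , (n ℕ.∸ fold z , s′∈ , - q - 1ℤ , trans (cong -_ z≡) (trans (ring (+ fold z) (+ n) q) (cong (λ s → s + + n * (- q - 1ℤ)) (sym (+∸ fold≤n)))))
    where
    fold≤n = ℕ.≤-trans (ℕ.m≤m+n (fold z) (fold z)) (fold-≤ z)
    ring : ∀ f n q → - (f + n * q) ≡ (n - f) + n * (- q - 1ℤ)
    ring = solve-∀
  ... | q , inj₂ z≡ = (n ℕ.∸ fold z , s′∈ , q - 1ℤ , trans z≡ (trans (ring (+ fold z) (+ n) q) (cong (λ s → s + + n * (q - 1ℤ)) (sym (+∸ fold≤n)))))
                    , (fold z , s∈ , - q , trans (cong -_ z≡) (ring′ (+ fold z) (+ n) q))
    where
    fold≤n = ℕ.≤-trans (ℕ.m≤m+n (fold z) (fold z)) (fold-≤ z)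
    ring : ∀ f n q → - f + n * q ≡ (n - f) + n * (q - 1ℤ)
    ring = solve-∀
    ring′ : ∀ f n q → - (- f + n * q) ≡ f + n * - q
    ring′ = solve-∀

  steps : ∀ {S} k (z : Fin k → ℤ) → (∀ l → Represented S (z l)) →
          ∃ λ ws → length ws ≡ k × All (_∈ S) ws × ∃ λ q → sum z ≡ + sumℕ ws + + n * q
  steps zero z _ = [] , refl , [] , 0ℤ , sym (trans (ℤ.+-identityˡ (+ n * 0ℤ)) (ℤ.*-zeroʳ (+ n)))
  steps (suc k) z rep with rep zero | steps k (z ∘ suc) (rep ∘ suc)
  ... | w , w∈ , q , z≡ | ws , len , ws∈ , q′ , sum≡ =
    w ∷ ws , cong suc len , w∈ ∷ ws∈ , q + q′ ,
    trans (cong₂ _+_ z≡ sum≡) (trans (ring (+ w) (+ sumℕ ws) (+ n) q q′)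
      (cong (λ s → s + + n * (q + q′)) (sym (ℤ.pos-+ w (sumℕ ws)))))
    where
    ring : ∀ w s n q q′ → (w + n * q) + (s + n * q′) ≡ (w + s) + n * (q + q′)
    ring = solve-∀

  -- A walk must exceed x by a natural multiple of n. A positive `q` would give x ≥ n, since the sum
  -- s is not negative.
  wrap : ∀ x s q → x ℕ.< n → + x ≡ + s + + n * q → ∃ λ q′ → s ≡ x ℕ.+ q′ ℕ.* n
  wrap x s (+ zero) x<n eq = 0 , trans (sym (ℤ.+-injective (trans eq (trans (cong (λ t → + s + t) (ℤ.*-zeroʳ (+ n))) (ℤ.+-identityʳ (+ s)))))) (sym (ℕ.+-identityʳ x))
  wrap x s (+ suc q) x<n eq = contradiction x<n (ℕ.≤⇒≯ (begin
    n                      ≤⟨ ℕ.m≤m*n n (suc q) ⟩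
    n ℕ.* suc q            ≤⟨ ℕ.m≤n+m (n ℕ.* suc q) s ⟩
    s ℕ.+ n ℕ.* suc q      ≡⟨ ℤ.+-injective (trans eq (trans (cong (λ t → + s + t) (sym (ℤ.pos-* n (suc q)))) (sym (ℤ.pos-+ s (n ℕ.* suc q))))) ⟨
    x                      ∎))
    where open ℕ.≤-Reasoning
  wrap x s -[1+ q ] x<n eq = suc q , ℤ.+-injective (begin
    + s                           ≡⟨ ring (+ s) (+ n) -[1+ q ] ⟩
    (+ s + + n * -[1+ q ]) + + suc q * + n ≡⟨ cong (λ t → t + + suc q * + n) eq ⟨
    + x + + suc q * + n           ≡⟨ cong (λ t → + x + t) (ℤ.pos-* (suc q) n) ⟨
    + x + + (suc q ℕ.* n)         ≡⟨ ℤ.pos-+ x (suc q ℕ.* n) ⟨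
    + (x ℕ.+ suc q ℕ.* n)         ∎)
    where
    open ≡-Reasoning
    ring : ∀ s n q → s ≡ (s + n * q) + (- q) * n
    ring = solve-∀

  walk : ∀ {S} k (z : Fin k → ℤ) q x → x ℕ.< n → (∀ l → Represented S (z l)) →
         + x ≡ sum z + + n * q → Walk S k n x
  walk k z q x x<n rep x≡ with steps k z rep
  ... | ws , len , ws∈ , q′ , sum≡ = ws , ℕ.≤-reflexive len , ws∈ ,
    wrap x (sumℕ ws) (q′ + q) x<n (trans x≡ (trans (cong (λ s → s + + n * q) sum≡) (ring (+ sumℕ ws) (+ n) q q′)))
    where
    ring : ∀ s n q q′ → (s + n * q′) + n * q ≡ s + n * (q′ + q)
    ring = solve-∀

-- The generators and the diameter

length-cartesianProductWith : ∀ {A B C : Set} (f : A → B → C) xs ys →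
                              length (cartesianProductWith f xs ys) ≡ length xs ℕ.* length ys
length-cartesianProductWith f []       ys = refl
length-cartesianProductWith f (x ∷ xs) ys = trans (length-++ (map (f x) ys))
  (cong₂ ℕ._+_ (length-map (f x) ys) (length-cartesianProductWith f xs ys))

interval : ℕ → List ℤ
interval L = map (λ j → + j - + L) (upTo (suc (2 ℕ.* L)))

length-interval : ∀ L → length (interval L) ≡ suc (2 ℕ.* L)
length-interval L = trans (length-map _ (upTo (suc (2 ℕ.* L)))) (length-upTo (suc (2 ℕ.* L)))

∈-interval : ∀ L y → ∣ y ∣ ℕ.≤ L → y ∈ interval L
∈-interval L y y≤ = subst (_∈ interval L) (trans (cong (_- + L) j≡) (ring y (+ L)))
                      (∈-map⁺ (λ j → + j - + L) (∈-upTo⁺ (s≤s j≤)))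
  where
  ring : ∀ y L → (y + L) - L ≡ y
  ring = solve-∀
  j = ∣ y + + L ∣
  j≤ : j ℕ.≤ 2 ℕ.* L
  j≤ = subst (j ℕ.≤_) (cong (L ℕ.+_) (sym (ℕ.+-identityʳ L))) (∣+∣≤ y (+ L) y≤ ℕ.≤-refl)
  0≤y+L : ∀ y → ∣ y ∣ ℕ.≤ L → 0ℤ ℤ.≤ y + + L
  0≤y+L (+ n) _ = ℤ.+≤+ z≤n
  0≤y+L -[1+ n ] n<L = subst (0ℤ ℤ.≤_) (sym (ℤ.⊖-≥ n<L)) (ℤ.+≤+ z≤n)
  j≡ : + j ≡ y + + L
  j≡ = ℤ.0≤i⇒+∣i∣≡i (0≤y+L y y≤)

sgn : Bool → ℤ
sgn true  = 1ℤ
sgn false = - 1ℤ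

-- The two omitted indices, the second one counted among the remaining k+1, and the signs of the others.
Pattern : ℕ → Set
Pattern k = Fin (suc (suc k)) × Fin (suc k) × Vec Bool k

value : ∀ {k} → (Fin (suc (suc k)) → ℕ) → Pattern k → ℤ
value t (a , b , ε) = sum λ l → sgn (lookup ε l) * + t (punchIn a (punchIn b l))

-- The condition 2t≢0 keeps the generators from being their own inverses.
record Template (k T : ℕ) .{{_ : ℕ.NonZero T}} : Set where
  field
    t        : Fin (suc (suc k)) → ℕ
    2t≢0     : ∀ i → (t i ℕ.+ t i) ℕ.% T ≢ 0
    complete : ∀ r → r ℕ.< T → ∃ λ p → value t p ℤ.%ℕ T ≡ r

pos-^ : ∀ m k → + (m ℕ.^ k) ≡ (+ m) ^ k
pos-^ m zero    = refl
pos-^ m (suc k) = trans (ℤ.pos-* m (m ℕ.^ k)) (cong (+ m *_) (pos-^ m k))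

module Construction {k T : ℕ} .{{_ : ℕ.NonZero T}} (template : Template k T) (s : ℕ) where

  open Template template
  open Cover k s using (M; h; lines; cover)

  n L : ℕ
  n = T ℕ.* M ℕ.^ k
  L = h ℕ.+ slack k

  n-nonZero : ℕ.NonZero n
  n-nonZero = ℕ.m*n≢0 T (M ℕ.^ k)
    where instance
      Mᵏ-nonZero : ℕ.NonZero (M ℕ.^ k)
      Mᵏ-nonZero = ℕ.m^n≢0 M k

  open Residues n ⦃ n-nonZero ⦄

  private
    n≡ : + n ≡ + T * (+ M) ^ k
    n≡ = trans (ℤ.pos-* T (M ℕ.^ k)) (cong (+ T *_) (pos-^ M k))

  generator : Fin (suc (suc k)) → ℤ → ℤ
  generator i y = + t i + + T * (lines i * y)

  generators : List ℕ
  generators = map fold (cartesianProductWith generator (allFin (suc (suc k))) (interval L))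

  length-generators : length generators ≡ suc (suc k) ℕ.* suc (2 ℕ.* L)
  length-generators = trans (length-map fold (cartesianProductWith generator (allFin (suc (suc k))) (interval L))) (trans (length-cartesianProductWith generator (allFin (suc (suc k))) (interval L))
    (cong₂ ℕ._*_ (length-tabulate {n = suc (suc k)} (λ i → i)) (length-interval L)))

  -- T divides n, and modulo T the double of a generator is 2tᵢ, which is not 0.
  generator-half : ∀ i y → Half n (fold (generator i y))
  generator-half i y = fold-half (generator i y) λ q eq → 2t≢0 i (begin
    (t i ℕ.+ t i) ℕ.% T                                ≡⟨ cong (ℕ._% T) (ℤ.+-injective {t i ℕ.+ t i} (main q eq)) ⟩
    (∣ c q ∣ ℕ.* T) ℕ.% T                              ≡⟨ ℕ.m*n%n≡0 ∣ c q ∣ T ⟩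
    0                                                  ∎)
    where
    open ≡-Reasoning
    Mᵏ = (+ M) ^ k
    c : ℤ → ℤ
    c q = Mᵏ * q - (lines i * y + lines i * y)
    ring₁ : ∀ t T g → t + t ≡ ((t + T * g) + (t + T * g)) - T * (g + g)
    ring₁ = solve-∀
    ring₂ : ∀ T m q g → T * m * q - T * (g + g) ≡ T * (m * q - (g + g))
    ring₂ = solve-∀
    2t≡ : ∀ q → generator i y + generator i y ≡ + n * q → + t i + + t i ≡ + T * c q
    2t≡ q eq = trans (ring₁ (+ t i) (+ T) (lines i * y)) (trans (cong (_- + T * (lines i * y + lines i * y))
                 (trans eq (cong (_* q) n≡))) (ring₂ (+ T) Mᵏ q (lines i * y)))
    main : ∀ q → generator i y + generator i y ≡ + n * q → + (t i ℕ.+ t i) ≡ + (∣ c q ∣ ℕ.* T)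
    main q eq = cong +_ (trans (cong ∣_∣ (2t≡ q eq)) (trans (ℤ.abs-* (+ T) (c q)) (ℕ.*-comm T ∣ c q ∣)))

  generators-half : All (Half n) generators
  generators-half = All.map⁺ (All.tabulate λ z∈ → half z∈)
    where
    half : ∀ {z} → z ∈ cartesianProductWith generator (allFin (suc (suc k))) (interval L) → Half n (fold z)
    half z∈ with i , y , _ , _ , refl ← ∈-cartesianProductWith⁻ generator (allFin (suc (suc k))) (interval L) z∈ =
      generator-half i y

  generator∈ : ∀ i y → ∣ y ∣ ℕ.≤ L → fold (generator i y) ∈ generators
  generator∈ i y y≤ = ∈-map⁺ fold (∈-cartesianProductWith⁺ generator (∈-allFin i) (∈-interval L y y≤))

  -- A pattern settles x modulo T and thereby fixes which two lines are omitted; `cover` then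
  -- represents the remaining quotient by T on the other k lines. Its error M^k R becomes a multiple
  -- of n = T M^k.
  reach : ∀ S → (∀ {v} → v ∈ generators → v ∈ S × n ℕ.∸ v ∈ S) → ∀ x → x ℕ.< n → Walk S k n x
  reach S closed x x<n = walk k z R x x<n represents (begin
    + x                                      ≡⟨ trans (cong +_ (trans (ℕ.m≡m%n+[m/n]*n x T) (cong (x ℕ.% T ℕ.+_) (ℕ.*-comm (x ℕ./ T) T)))) (trans (ℤ.pos-+ (x ℕ.% T) (T ℕ.* (x ℕ./ T))) (cong (λ s → + (x ℕ.% T) + s) (ℤ.pos-* T (x ℕ./ T)))) ⟩
    + (x ℕ.% T) + + T * + (x ℕ./ T)          ≡⟨ cong (λ s → + s + + T * + (x ℕ./ T)) value≡ ⟨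
    + (v ℤ.%ℕ T) + + T * + (x ℕ./ T)         ≡⟨ ring₁ (+ (v ℤ.%ℕ T)) (+ T) (+ (x ℕ./ T)) (v ℤ./ℕ T) ⟩
    (+ (v ℤ.%ℕ T) + + T * (v ℤ./ℕ T)) + + T * (+ (x ℕ./ T) - v ℤ./ℕ T)
                                             ≡⟨ cong₂ (λ v q → v + + T * q) (sym (divℕ v T)) Q≡ ⟩
    v + + T * (y ∙ g + (+ M) ^ k * R)        ≡⟨ ring₂ v (+ T) (y ∙ g) ((+ M) ^ k) R ⟩
    (v + + T * y ∙ g) + + T * (+ M) ^ k * R  ≡⟨ cong₂ (λ s n → s + n * R) z-sum (sym n≡) ⟩
    sum z + + n * R                          ∎)
    where
    open ≡-Reasoning
    pattern-of = complete (x ℕ.% T) (ℕ.m%n<n x T)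
    a : Fin (suc (suc k))
    a = proj₁ (proj₁ pattern-of)
    b : Fin (suc k)
    b = proj₁ (proj₂ (proj₁ pattern-of))
    ε : Vec Bool k
    ε = proj₂ (proj₂ (proj₁ pattern-of))
    v : ℤ
    v = value t (a , b , ε)
    value≡ : v ℤ.%ℕ T ≡ x ℕ.% T
    value≡ = proj₂ pattern-of
    solution = cover a b (+ (x ℕ./ T) - v ℤ./ℕ T)
    y : Fin k → ℤ
    y = proj₁ solution
    R : ℤ
    R = proj₁ (proj₂ solution)
    Q≡ : + (x ℕ./ T) - v ℤ./ℕ T ≡ y ∙ (λ l → lines (punchIn a (punchIn b l))) + (+ M) ^ k * R
    Q≡ = proj₁ (proj₂ (proj₂ solution))
    y≤ : ∀ l → ∣ y l ∣ ℕ.≤ L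
    y≤ = proj₂ (proj₂ (proj₂ solution))
    σ : Fin k → ℤ
    σ l = sgn (lookup ε l)
    p : Fin k → Fin (suc (suc k))
    p l = punchIn a (punchIn b l)
    g : Fin k → ℤ
    g l = lines (p l)
    z : Fin k → ℤ
    -- The sign also enters the argument, as σ(t + T g σ y) = σ t + T g y; the interval of
    -- admissible arguments is symmetric.
    z l = σ l * generator (p l) (σ l * y l)
    σσ : ∀ β → sgn β * sgn β ≡ 1ℤ
    σσ true  = refl
    σσ false = refl
    ∣σ∣ : ∀ β y → ∣ sgn β * y ∣ ≡ ∣ y ∣
    ∣σ∣ true  y = cong ∣_∣ (ℤ.*-identityˡ y)
    ∣σ∣ false y = trans (cong ∣_∣ (ℤ.-1*i≡-i y)) (ℤ.∣-i∣≡∣i∣ y)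
    ring₁ : ∀ r T x q → r + T * x ≡ (r + T * q) + T * (x - q)
    ring₁ = solve-∀
    ring₂ : ∀ v T s m R → v + T * (s + m * R) ≡ (v + T * s) + T * m * R
    ring₂ = solve-∀
    ring₃ : ∀ σ t T g y → σ * (t + T * (g * (σ * y))) ≡ σ * t + T * (σ * σ * y * g)
    ring₃ = solve-∀
    z-sum : v + + T * y ∙ g ≡ sum z
    z-sum = sym (begin
      sum z                                                      ≡⟨ sum-cong-≗ (λ l → trans (ring₃ (σ l) (+ t (p l)) (+ T) (g l) (y l))
                                                                     (cong (λ s → σ l * + t (p l) + + T * (s * g l)) (trans (cong (_* y l) (σσ (lookup ε l))) (ℤ.*-identityˡ (y l))))) ⟩
      sum (λ l → σ l * + t (p l) + + T * (y l * g l))            ≡⟨ ∑-distrib-+ (λ l → σ l * + t (p l)) (λ l → + T * (y l * g l)) ⟩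
      v + sum (λ l → + T * (y l * g l))                          ≡⟨ cong (λ s → v + s) (*-distribˡ-sum (+ T) (λ l → y l * g l)) ⟨
      v + + T * y ∙ g                                            ∎)
    signed : ∀ β {x} → Represented S x × Represented S (- x) → Represented S (sgn β * x)
    signed true  {x} (r , _) = subst (Represented S) (sym (ℤ.*-identityˡ x)) r
    signed false {x} (_ , r) = subst (Represented S) (sym (ℤ.-1*i≡-i x)) r
    represents : ∀ l → Represented S (z l)
    represents l = signed (lookup ε l) (represented (generator (p l) (σ l * y l)) (proj₁ both) (proj₂ both))
      where
      both = closed (generator∈ (p l) (σ l * y l) (subst (ℕ._≤ L) (sym (∣σ∣ (lookup ε l) (y l))) (y≤ l)))

  circulant : ∀ {N} mid → All (λ v → v ℕ.+ v ≡ n) mid → Unique mid →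
              suc (suc k) ℕ.* suc (2 ℕ.* L) ℕ.≤ N → N ℕ.+ N ℕ.< n →
              Circulant (N ℕ.+ (N ℕ.+ length mid)) k n
  circulant mid mid≡ mid! ≤N 2N<n =
    symmetrize mid generators (ℕ.>-nonZero⁻¹ n ⦃ n-nonZero ⦄) mid≡ mid! generators-half
      (ℕ.≤-trans (ℕ.≤-reflexive length-generators) ≤N) 2N<n reach

-- Matching a prescribed degree, and the order obtained

halve : ∀ d → ∃ λ N → d ≡ N ℕ.+ N ⊎ d ≡ suc (N ℕ.+ N)
halve zero = 0 , inj₁ refl
halve (suc d) with halve d
... | N , inj₁ refl = N , inj₂ refl
... | N , inj₂ refl = suc N , inj₁ (cong suc (sym (ℕ.+-suc N N)))

Even : ℕ → Set
Even n = ∃ λ m → m ℕ.+ m ≡ n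

module Orders {k T : ℕ} .{{_ : ℕ.NonZero T}} (2≤k : 2 ℕ.≤ k) (template : Template k T) where

  private
    f F D base : ℕ
    f = suc (suc k)
    F = 2 ℕ.* f
    D = suc k !
    -- `base` is the number of listed generators for s = 0, and each unit of s adds `step` to it.
    base = f ℕ.* suc (2 ℕ.* slack k)
    step : ℕ
    step = 2 ℕ.* f ℕ.* D
    instance
      D-nonZero : ℕ.NonZero D
      D-nonZero = suc k ℕ.!≢0
      step-nonZero : ℕ.NonZero step
      step-nonZero = ℕ.m*n≢0 (2 ℕ.* f) D

  -- A bound for d - F M: 1 for the parity of d, and twice `base` plus one `step` lost in rounding.
  remainder : ℕ
  remainder = suc (2 ℕ.* (base ℕ.+ step))

  -- Beyond it d ≤ F M + `remainder` forces M > F + `remainder`, and so d < M².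
  threshold : ℕ
  threshold = suc (F ℕ.* (F ℕ.+ remainder) ℕ.+ remainder)

  large : ∀ d → threshold ℕ.≤ d → Even T ⊎ Even d →
          ∃ λ m → Circulant d k (T ℕ.* m ℕ.^ k) × d ℕ.≤ F ℕ.* m ℕ.+ remainder
  large d d≥ parity with halve d
  ... | N , half = M , circ half parity , d≤
    where
    -- The largest s for which the generators fit into N pairs.
    s : ℕ
    s = (N ℕ.∸ base) ℕ./ step
    open Cover k s using (M)
    open Construction template s using (n; L; circulant)
    2N≤d : N ℕ.+ N ℕ.≤ d
    2N≤d = [ (λ eq → ℕ.≤-reflexive (sym eq)) , (λ eq → ℕ.≤-trans (ℕ.n≤1+n _) (ℕ.≤-reflexive (sym eq))) ]′ half
    d≤2N+1 : d ℕ.≤ suc (2 ℕ.* N)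
    d≤2N+1 = subst (λ t → d ℕ.≤ suc (N ℕ.+ t)) (sym (ℕ.+-identityʳ N)) ([ (λ eq → ℕ.≤-trans (ℕ.≤-reflexive eq) (ℕ.n≤1+n _)) , ℕ.≤-reflexive ]′ half)
    d≤ : d ℕ.≤ F ℕ.* M ℕ.+ remainder
    d≤ = begin
      d                                                  ≤⟨ d≤2N+1 ⟩
      suc (2 ℕ.* N)                                      ≤⟨ s≤s (ℕ.*-monoʳ-≤ 2 (ℕ.m≤n+m∸n N base)) ⟩
      suc (2 ℕ.* (base ℕ.+ (N ℕ.∸ base)))                ≡⟨ cong (λ t → suc (2 ℕ.* (base ℕ.+ t))) (ℕ.m≡m%n+[m/n]*n (N ℕ.∸ base) step) ⟩
      suc (2 ℕ.* (base ℕ.+ ((N ℕ.∸ base) ℕ.% step ℕ.+ s ℕ.* step)))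
                                                         ≤⟨ s≤s (ℕ.*-monoʳ-≤ 2 (ℕ.+-monoʳ-≤ base (ℕ.+-monoˡ-≤ (s ℕ.* step) (ℕ.<⇒≤ (ℕ.m%n<n (N ℕ.∸ base) step))))) ⟩
      suc (2 ℕ.* (base ℕ.+ (step ℕ.+ s ℕ.* step)))       ≤⟨ ℕ.m≤n+m _ F ⟩
      F ℕ.+ suc (2 ℕ.* (base ℕ.+ (step ℕ.+ s ℕ.* step))) ≡⟨ ring f D s base ⟩
      F ℕ.* M ℕ.+ remainder                              ∎
      where
      open ℕ.≤-Reasoning
      ring : ∀ f D s b → 2 ℕ.* f ℕ.+ (1 ℕ.+ 2 ℕ.* (b ℕ.+ (2 ℕ.* f ℕ.* D ℕ.+ s ℕ.* (2 ℕ.* f ℕ.* D))))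
                       ≡ 2 ℕ.* f ℕ.* (1 ℕ.+ 2 ℕ.* (s ℕ.* D)) ℕ.+ (1 ℕ.+ 2 ℕ.* (b ℕ.+ 2 ℕ.* f ℕ.* D))
      ring = solve-∀ℕ
    base≤N : base ℕ.≤ N
    base≤N = ℕ.≮⇒≥ λ N<base → ℕ.<-irrefl refl (begin-strict
      d                                      ≤⟨ d≤2N+1 ⟩
      suc (2 ℕ.* N)                          ≤⟨ s≤s (ℕ.*-monoʳ-≤ 2 (ℕ.≤-trans (ℕ.<⇒≤ N<base) (ℕ.m≤m+n base step))) ⟩
      remainder                              ≤⟨ ℕ.m≤n+m remainder (F ℕ.* (F ℕ.+ remainder)) ⟩
      F ℕ.* (F ℕ.+ remainder) ℕ.+ remainder  <⟨ d≥ ⟩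
      d                                      ∎)
      where open ℕ.≤-Reasoning
    fits : f ℕ.* suc (2 ℕ.* L) ℕ.≤ N
    fits = begin
      f ℕ.* suc (2 ℕ.* L)              ≡⟨ ring f D s (slack k) ⟩
      base ℕ.+ s ℕ.* step              ≤⟨ ℕ.+-monoʳ-≤ base (ℕ.m/n*n≤m (N ℕ.∸ base) step) ⟩
      base ℕ.+ (N ℕ.∸ base)            ≡⟨ ℕ.m+[n∸m]≡n base≤N ⟩
      N                                ∎
      where
      open ℕ.≤-Reasoning
      ring : ∀ f D s c → f ℕ.* (1 ℕ.+ 2 ℕ.* (s ℕ.* D ℕ.+ c)) ≡ f ℕ.* (1 ℕ.+ 2 ℕ.* c) ℕ.+ s ℕ.* (2 ℕ.* f ℕ.* D)
      ring = solve-∀ℕ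
    M> : F ℕ.+ remainder ℕ.< M
    M> = ℕ.≰⇒> λ M≤ → ℕ.<-irrefl refl (begin-strict
      d                                      ≤⟨ d≤ ⟩
      F ℕ.* M ℕ.+ remainder                  ≤⟨ ℕ.+-monoˡ-≤ remainder (ℕ.*-monoʳ-≤ F M≤) ⟩
      F ℕ.* (F ℕ.+ remainder) ℕ.+ remainder  <⟨ d≥ ⟩
      d                                      ∎)
      where open ℕ.≤-Reasoning
    -- d ≤ (F + `remainder`) M < M², and M² ≤ M^k by `2≤k`.
    2N<n : N ℕ.+ N ℕ.< n
    2N<n = begin-strict
      N ℕ.+ N                                ≤⟨ 2N≤d ⟩
      d                                      ≤⟨ d≤ ⟩
      F ℕ.* M ℕ.+ remainder                  ≤⟨ ℕ.+-monoʳ-≤ (F ℕ.* M) (ℕ.m≤m*n remainder M) ⟩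
      F ℕ.* M ℕ.+ remainder ℕ.* M            ≡⟨ ℕ.*-distribʳ-+ M F remainder ⟨
      (F ℕ.+ remainder) ℕ.* M                <⟨ ℕ.*-monoˡ-< M M> ⟩
      M ℕ.* M                                ≡⟨ cong (M ℕ.*_) (ℕ.*-identityʳ M) ⟨
      M ℕ.^ 2                                ≤⟨ ℕ.^-monoʳ-≤ M 2≤k ⟩
      M ℕ.^ k                                ≤⟨ ℕ.m≤n*m (M ℕ.^ k) T ⟩
      n                                      ∎
      where open ℕ.≤-Reasoning
    circ : d ≡ N ℕ.+ N ⊎ d ≡ suc (N ℕ.+ N) → Even T ⊎ Even d → Circulant d k n
    circ (inj₁ refl) _ = subst (λ d → Circulant d k n) (cong (N ℕ.+_) (ℕ.+-identityʳ N)) (circulant [] [] [] fits 2N<n)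
    -- For odd d the extra element is the involution n / 2 = T′ M^k.
    circ (inj₂ refl) (inj₁ (T′ , refl)) =
      subst (λ d → Circulant d k n) (trans (cong (N ℕ.+_) (ℕ.+-comm N 1)) (ℕ.+-suc N N))
        (circulant (T′ ℕ.* M ℕ.^ k ∷ []) (sym (ℕ.*-distribʳ-+ (M ℕ.^ k) T′ T′) ∷ []) ([] ∷ []) fits 2N<n)
    circ (inj₂ refl) (inj₂ (m , eq)) = contradiction eq (odd m N)
      where
      odd : ∀ m N → m ℕ.+ m ≢ suc (N ℕ.+ N)
      odd (suc m) N eq with trans (sym (ℕ.+-suc m m)) (ℕ.suc-injective eq)
      odd (suc m) (suc N) eq | eq′ = odd m N (ℕ.suc-injective (trans eq′ (cong suc (ℕ.+-suc N N))))

-- Bernoulli's inequality (1 - R/d)^k ≥ 1 - kR/d for a ≥ d - R, multiplied by d^(k+1) and arranged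
-- without subtraction.
bernoulli : ∀ k a d R → d ℕ.≤ a ℕ.+ R → d ℕ.^ k ℕ.* d ℕ.≤ d ℕ.* a ℕ.^ k ℕ.+ k ℕ.* R ℕ.* d ℕ.^ k
bernoulli k a d R d≤ with ℕ.≤-total d a
... | inj₁ d≤a = begin
  d ℕ.^ k ℕ.* d                                ≡⟨ ℕ.*-comm (d ℕ.^ k) d ⟩
  d ℕ.* d ℕ.^ k                                ≤⟨ ℕ.*-monoʳ-≤ d (ℕ.^-monoˡ-≤ k d≤a) ⟩
  d ℕ.* a ℕ.^ k                                ≤⟨ ℕ.m≤m+n _ _ ⟩
  d ℕ.* a ℕ.^ k ℕ.+ k ℕ.* R ℕ.* d ℕ.^ k        ∎
  where open ℕ.≤-Reasoning
... | inj₂ a≤d = induct k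
  where
  open ℕ.≤-Reasoning
  ring₁ : ∀ d X → d ℕ.* X ℕ.* d ≡ X ℕ.* d ℕ.* d
  ring₁ = solve-∀ℕ
  ring₂ : ∀ X d a R → X ℕ.* d ℕ.* (a ℕ.+ R) ≡ a ℕ.* (X ℕ.* d) ℕ.+ R ℕ.* (d ℕ.* X)
  ring₂ = solve-∀ℕ
  ring₃ : ∀ d a A k R X → a ℕ.* (d ℕ.* A ℕ.+ k ℕ.* R ℕ.* X) ℕ.+ R ℕ.* (d ℕ.* X)
                        ≡ d ℕ.* (a ℕ.* A) ℕ.+ (k ℕ.* R ℕ.* (a ℕ.* X) ℕ.+ R ℕ.* (d ℕ.* X))
  ring₃ = solve-∀ℕ
  ring₄ : ∀ k R Y → k ℕ.* R ℕ.* Y ℕ.+ R ℕ.* Y ≡ (1 ℕ.+ k) ℕ.* R ℕ.* Y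
  ring₄ = solve-∀ℕ
  induct : ∀ k → d ℕ.^ k ℕ.* d ℕ.≤ d ℕ.* a ℕ.^ k ℕ.+ k ℕ.* R ℕ.* d ℕ.^ k
  induct zero    = ℕ.≤-reflexive (trans (ℕ.*-identityˡ d) (sym (trans (ℕ.+-identityʳ _) (ℕ.*-identityʳ d))))
  induct (suc k) = begin
    d ℕ.* d ℕ.^ k ℕ.* d                              ≡⟨ ring₁ d (d ℕ.^ k) ⟩
    d ℕ.^ k ℕ.* d ℕ.* d                              ≤⟨ ℕ.*-monoʳ-≤ (d ℕ.^ k ℕ.* d) d≤ ⟩
    d ℕ.^ k ℕ.* d ℕ.* (a ℕ.+ R)                      ≡⟨ ring₂ (d ℕ.^ k) d a R ⟩
    a ℕ.* (d ℕ.^ k ℕ.* d) ℕ.+ R ℕ.* d ℕ.^ suc k      ≤⟨ ℕ.+-monoˡ-≤ _ (ℕ.*-monoʳ-≤ a (induct k)) ⟩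
    a ℕ.* (d ℕ.* a ℕ.^ k ℕ.+ k ℕ.* R ℕ.* d ℕ.^ k) ℕ.+ R ℕ.* d ℕ.^ suc k
                                                     ≡⟨ ring₃ d a (a ℕ.^ k) k R (d ℕ.^ k) ⟩
    d ℕ.* a ℕ.^ suc k ℕ.+ (k ℕ.* R ℕ.* (a ℕ.* d ℕ.^ k) ℕ.+ R ℕ.* d ℕ.^ suc k)
                                                     ≤⟨ ℕ.+-monoʳ-≤ (d ℕ.* a ℕ.^ suc k) (ℕ.+-monoˡ-≤ _ (ℕ.*-monoʳ-≤ (k ℕ.* R) (ℕ.*-monoˡ-≤ (d ℕ.^ k) a≤d))) ⟩
    d ℕ.* a ℕ.^ suc k ℕ.+ (k ℕ.* R ℕ.* d ℕ.^ suc k ℕ.+ R ℕ.* d ℕ.^ suc k)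
                                                     ≡⟨ cong (d ℕ.* a ℕ.^ suc k ℕ.+_) (ring₄ k R (d ℕ.^ suc k)) ⟩
    d ℕ.* a ℕ.^ suc k ℕ.+ suc k ℕ.* R ℕ.* d ℕ.^ suc k ∎

^-distribʳ-* : ∀ k m n → (m ℕ.* n) ℕ.^ k ≡ m ℕ.^ k ℕ.* n ℕ.^ k
^-distribʳ-* zero    m n = refl
^-distribʳ-* (suc k) m n = trans (cong (m ℕ.* n ℕ.*_) (^-distribʳ-* k m n)) (ring m n (m ℕ.^ k) (n ℕ.^ k))
  where
  ring : ∀ m n a b → m ℕ.* n ℕ.* (a ℕ.* b) ≡ m ℕ.* a ℕ.* (n ℕ.* b)
  ring = solve-∀ℕ

-- Divided by F^k E this is (T / F^k - 1/E) d^k ≤ T m^k. The loss T k R / d from `bernoulli` is at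
-- most 1/E by `small`; E will be the denominator of ε.
order-bound : ∀ k T F E m R d .{{_ : ℕ.NonZero F}} → 0 ℕ.< d →
              d ℕ.≤ F ℕ.* m ℕ.+ R → T ℕ.* E ℕ.* (k ℕ.* R) ℕ.≤ d →
              T ℕ.* E ℕ.* d ℕ.^ k ℕ.≤ (T ℕ.* m ℕ.^ k) ℕ.* (F ℕ.^ k ℕ.* E) ℕ.+ F ℕ.^ k ℕ.* d ℕ.^ k
order-bound k T F E m R d 0<d d≤ small = ℕ.*-cancelʳ-≤ _ _ d ⦃ ℕ.>-nonZero 0<d ⦄ $ begin
  T ℕ.* E ℕ.* X ℕ.* d                                    ≡⟨ ℕ.*-assoc (T ℕ.* E) X d ⟩
  T ℕ.* E ℕ.* (X ℕ.* d)                                  ≤⟨ ℕ.*-monoʳ-≤ (T ℕ.* E) (bernoulli k (F ℕ.* m) d R d≤) ⟩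
  T ℕ.* E ℕ.* (d ℕ.* (F ℕ.* m) ℕ.^ k ℕ.+ k ℕ.* R ℕ.* X)  ≡⟨ cong (λ A → T ℕ.* E ℕ.* (d ℕ.* A ℕ.+ k ℕ.* R ℕ.* X)) (^-distribʳ-* k F m) ⟩
  T ℕ.* E ℕ.* (d ℕ.* (G ℕ.* m ℕ.^ k) ℕ.+ k ℕ.* R ℕ.* X)  ≡⟨ ring₁ T E d G (m ℕ.^ k) (k ℕ.* R) X ⟩
  (T ℕ.* m ℕ.^ k) ℕ.* (G ℕ.* E) ℕ.* d ℕ.+ T ℕ.* E ℕ.* (k ℕ.* R) ℕ.* X
                                                         ≤⟨ ℕ.+-monoʳ-≤ _ (ℕ.*-monoˡ-≤ X small) ⟩
  (T ℕ.* m ℕ.^ k) ℕ.* (G ℕ.* E) ℕ.* d ℕ.+ d ℕ.* X        ≤⟨ ℕ.+-monoʳ-≤ _ (ℕ.m≤n*m (d ℕ.* X) G ⦃ ℕ.m^n≢0 F k ⦄) ⟩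
  (T ℕ.* m ℕ.^ k) ℕ.* (G ℕ.* E) ℕ.* d ℕ.+ G ℕ.* (d ℕ.* X) ≡⟨ ring₂ (T ℕ.* m ℕ.^ k ℕ.* (G ℕ.* E)) G d X ⟩
  ((T ℕ.* m ℕ.^ k) ℕ.* (G ℕ.* E) ℕ.+ G ℕ.* X) ℕ.* d      ∎
  where
  open ℕ.≤-Reasoning
  X G : ℕ
  X = d ℕ.^ k
  G = F ℕ.^ k
  ring₁ : ∀ T E d G m r X → T ℕ.* E ℕ.* (d ℕ.* (G ℕ.* m) ℕ.+ r ℕ.* X) ≡ T ℕ.* m ℕ.* (G ℕ.* E) ℕ.* d ℕ.+ T ℕ.* E ℕ.* r ℕ.* X
  ring₁ = solve-∀ℕ
  ring₂ : ∀ A G d X → A ℕ.* d ℕ.+ G ℕ.* (d ℕ.* X) ≡ (A ℕ.+ G ℕ.* X) ℕ.* d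
  ring₂ = solve-∀ℕ

-- Finite verification of the residue patterns

signings : ∀ k → List (Vec Bool k)
signings zero    = [] ∷ []
signings (suc k) = cartesianProductWith _∷_ (true ∷ false ∷ []) (signings k)

patterns : ∀ k → List (Pattern k)
patterns k = cartesianProduct (allFin (suc (suc k))) (cartesianProduct (allFin (suc k)) (signings k))

reached : ∀ k T .{{_ : ℕ.NonZero T}} → Vec ℕ (suc (suc k)) → List ℕ
reached k T ts = map (λ p → value (lookup ts) p ℤ.%ℕ T) (patterns k)

all-in? : ∀ (xs : List ℕ) T → Dec (All (_∈ xs) (upTo T))
all-in? xs T = All.all? (_∈? xs) (upTo T)

-- For concrete residues both decisions evaluate to `yes`, so that the `True` arguments become unit
-- types and `_` fills them.
template : ∀ k T .{{_ : ℕ.NonZero T}} (ts : Vec ℕ (suc (suc k))) →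
           True (Fin.all? λ i → ¬? ((lookup ts i ℕ.+ lookup ts i) ℕ.% T ℕ.≟ 0)) →
           True (all-in? (reached k T ts) T) → Template k T
template k T ts 2t≢0 complete = record
  { t        = lookup ts
  ; 2t≢0     = toWitness 2t≢0
  ; complete = λ r r<T → let p , _ , eq = ∈-map⁻ (λ p → value (lookup ts) p ℤ.%ℕ T) (All.lookup (toWitness complete) (∈-upTo⁺ r<T)) in p , sym eq
  }

-- The residues below were found by computer search.
template₅₆ : Template 3 56
template₅₆ = template 3 56 (3 ∷ 6 ∷ 11 ∷ 14 ∷ 21 ∷ []) _ _

template₅₇ : Template 3 57
template₅₇ = template 3 57 (2 ∷ 13 ∷ 15 ∷ 22 ∷ 27 ∷ []) _ _

template₁₅₀ : Template 4 150
template₁₅₀ = template 4 150 (28 ∷ 46 ∷ 52 ∷ 53 ∷ 58 ∷ 73 ∷ []) _ _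

template₄₃₆ : Template 5 436
template₄₃₆ = template 5 436 (5 ∷ 22 ∷ 109 ∷ 131 ∷ 145 ∷ 171 ∷ 202 ∷ []) _ _

-- From integer inequalities to rational bounds

ℕtoℚ-toℚᵘ : ∀ n → toℚᵘ (ℕtoℚ n) ℚᵘ.≃ mkℚᵘ (+ n) 0
ℕtoℚ-toℚᵘ n = ℚ.toℚᵘ-fromℚᵘ (mkℚᵘ (+ n) 0)

-- In unnormalised rationals no common factors are cancelled, so the claim is literally the
-- cross-multiplied inequality.
scaled-≤ : ∀ q ε X n → (↥ q * ↧ ε + - ↥ ε * ↧ q) * + X ℤ.≤ + n * (↧ q * ↧ ε) →
           (q ℚ.- ε) ℚ.* ℕtoℚ X ℚ.≤ ℕtoℚ n
scaled-≤ q@record{} ε@record{} X n le = ℚ.toℚᵘ-cancel-≤ $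
  ℚᵘ.≤-respˡ-≃ (ℚᵘ.≃-sym lhs) (ℚᵘ.≤-respʳ-≃ (ℚᵘ.≃-sym (ℕtoℚ-toℚᵘ n)) (*≤* cross))
  where
  lhs : toℚᵘ ((q ℚ.- ε) ℚ.* ℕtoℚ X) ℚᵘ.≃ (toℚᵘ q ℚᵘ.- toℚᵘ ε) ℚᵘ.* mkℚᵘ (+ X) 0
  lhs = ℚᵘ.≃-trans (ℚ.toℚᵘ-homo-* (q ℚ.- ε) (ℕtoℚ X))
          (ℚᵘ.*-cong (ℚᵘ.≃-trans (ℚ.toℚᵘ-homo-+ q (ℚ.- ε)) (ℚᵘ.+-congʳ (toℚᵘ q) (ℚ.toℚᵘ-homo‿- ε))) (ℕtoℚ-toℚᵘ X))
  cross : (↥ q * ↧ ε + - ↥ ε * ↧ q) * + X * + 1 ℤ.≤ + n * + (↧ₙ q ℕ.* ↧ₙ ε ℕ.* 1)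
  cross = subst₂ ℤ._≤_ (sym (ℤ.*-identityʳ _)) (cong (+ n *_) (trans (sym (ℤ.pos-* (↧ₙ q) (↧ₙ ε))) (cong +_ (sym (ℕ.*-identityʳ _))))) le

-- In fractions: p/Q ≤ T/G and (T/G - 1/E) X ≤ n give (p/Q - P/E) X ≤ n, because P ≥ 1.
deficit-≤ : ∀ p (Q E P X n G T : ℕ) → 0 ℕ.< G → 0 ℕ.< P → p * + G ℤ.≤ + T * + Q →
            T ℕ.* E ℕ.* X ℕ.≤ n ℕ.* (G ℕ.* E) ℕ.+ G ℕ.* X →
            (p * + E + - (+ P) * + Q) * + X ℤ.≤ + n * (+ Q * + E)
deficit-≤ p Q E P X n G@(suc _) T _ 0<P pG≤ le = ℤ.*-cancelʳ-≤-pos _ _ (+ G) $ begin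
  (p * + E + - (+ P) * + Q) * + X * + G                     ≡⟨ ring₁ p (+ E) (+ P) (+ Q) (+ X) (+ G) ⟩
  p * + G * (+ E * + X) - + P * (+ Q * + X * + G)           ≡⟨ cong₂ (λ s t → p * + G * s - + P * t) (sym (ℤ.pos-* E X)) (pos₃ Q X G) ⟩
  p * + G * + (E ℕ.* X) - + P * + (Q ℕ.* X ℕ.* G)           ≤⟨ ℤ.+-mono-≤ (ℤ.*-monoʳ-≤-nonNeg (+ (E ℕ.* X)) pG≤) (ℤ.neg-mono-≤ (ℤ.*-monoʳ-≤-nonNeg (+ (Q ℕ.* X ℕ.* G)) (ℤ.+≤+ 0<P))) ⟩
  + T * + Q * + (E ℕ.* X) - + 1 * + (Q ℕ.* X ℕ.* G)         ≡⟨ cong₂ (λ s t → + T * + Q * s - + 1 * t) (ℤ.pos-* E X) (sym (pos₃ Q X G)) ⟩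
  + T * + Q * (+ E * + X) - + 1 * (+ Q * + X * + G)         ≡⟨ ring₂ (+ T) (+ Q) (+ E) (+ X) (+ G) ⟩
  + Q * (+ T * + E * + X - + G * + X)                       ≤⟨ ℤ.*-monoˡ-≤-nonNeg (+ Q) (ℤ.+-monoˡ-≤ (- (+ G * + X)) le′) ⟩
  + Q * ((+ n * (+ G * + E) + + G * + X) - + G * + X)       ≡⟨ ring₃ (+ Q) (+ n) (+ G) (+ E) (+ X) ⟩
  + n * (+ Q * + E) * + G                                   ∎
  where
  open ℤ.≤-Reasoning
  pos₃ : ∀ a b c → + a * + b * + c ≡ + (a ℕ.* b ℕ.* c)
  pos₃ a b c = trans (cong (_* + c) (sym (ℤ.pos-* a b))) (sym (ℤ.pos-* (a ℕ.* b) c))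
  le′ : + T * + E * + X ℤ.≤ + n * (+ G * + E) + + G * + X
  le′ = subst₂ ℤ._≤_ (sym (pos₃ T E X))
          (trans (ℤ.pos-+ (n ℕ.* (G ℕ.* E)) (G ℕ.* X)) (cong₂ _+_ (trans (ℤ.pos-* n (G ℕ.* E)) (cong (+ n *_) (ℤ.pos-* G E))) (ℤ.pos-* G X)))
          (ℤ.+≤+ le)
  ring₁ : ∀ p E P Q X G → (p * E + - P * Q) * X * G ≡ p * G * (E * X) - P * (Q * X * G)
  ring₁ = solve-∀
  ring₂ : ∀ T Q E X G → T * Q * (E * X) - + 1 * (Q * X * G) ≡ Q * (T * E * X - G * X)
  ring₂ = solve-∀
  ring₃ : ∀ Q n G E X → Q * ((n * (G * E) + G * X) - G * X) ≡ n * (Q * E) * G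
  ring₃ = solve-∀

-- q ≤ T / (2 (k + 2))ᵏ
AtMostDensity : ℕ → ℕ → ℚ → Set
AtMostDensity k T q = ↥ q * + ((2 ℕ.* suc (suc k)) ℕ.^ k) ℤ.≤ + T * ↧ q

atMostDensity? : ∀ k T q → Dec (AtMostDensity k T q)
atMostDensity? k T q = _ ℤ.≤? _

-- Lower bounds for the limits

module Asymptotics {k T : ℕ} {2≤k : True (2 ℕ.≤? k)} .{{_ : ℕ.NonZero T}} (template : Template k T) where

  open Orders (toWitness 2≤k) template

  private
    F : ℕ
    F = 2 ℕ.* suc (suc k)

    -- The first summand lets the graph exist, the second makes the loss in `order-bound` small
    -- enough for ε.
    degree-from : ℚ → ℕ
    degree-from ε = threshold ℕ.+ T ℕ.* ↧ₙ ε ℕ.* (k ℕ.* remainder)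

    bound : ∀ q ε → AtMostDensity k T q → 0ℚ ℚ.< ε → ∀ d → degree-from ε ℕ.≤ d →
            Even T ⊎ Even d → CCbound k d (q ℚ.- ε)
    bound q (mkℚ (+ 0)      _ _) _ (ℚ.*<* (ℤ.+<+ ()))
    bound q (mkℚ -[1+ _ ]   _ _) _ (ℚ.*<* ())
    bound q ε@(mkℚ +[1+ P ] _ _) q≤ _ d d≥ parity = T ℕ.* m ℕ.^ k , proj₁ (proj₂ found) ,
      scaled-≤ q ε (d ℕ.^ k) (T ℕ.* m ℕ.^ k)
        (deficit-≤ (↥ q) (↧ₙ q) (↧ₙ ε) (suc P) (d ℕ.^ k) (T ℕ.* m ℕ.^ k) (F ℕ.^ k) T
          (ℕ.m^n>0 F k) (s≤s z≤n) q≤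
          (order-bound k T F (↧ₙ ε) m remainder d
            (ℕ.≤-trans (s≤s z≤n) d≥threshold) (proj₂ (proj₂ found)) (ℕ.m+n≤o⇒n≤o threshold d≥)))
      where
      d≥threshold : threshold ℕ.≤ d
      d≥threshold = ℕ.m+n≤o⇒m≤o threshold d≥
      found = large d d≥threshold parity
      m : ℕ
      m = proj₁ found

  lower : Even T → ∀ q → {True (atMostDensity? k T q)} → LminusGE k q
  lower even q {q≤} ε 0<ε = degree-from ε , λ d d≥ → bound q ε (toWitness q≤) 0<ε d d≥ (inj₁ even)

  -- If T is odd, so is the order, and only even degrees are available.
  upper : ∀ q → {True (atMostDensity? k T q)} → LplusGE k q
  upper q {q≤} ε 0<ε D =
    d , ℕ.m≤n+m D d₀ ⟨≤⟩ ℕ.m≤m+n (d₀ ℕ.+ D) _ ,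
    bound q ε (toWitness q≤) 0<ε d (ℕ.m≤m+n d₀ D ⟨≤⟩ ℕ.m≤m+n (d₀ ℕ.+ D) _) (inj₂ (d₀ ℕ.+ D , refl))
    where
    _⟨≤⟩_ = ℕ.≤-trans
    d₀ = degree-from ε
    d = (d₀ ℕ.+ D) ℕ.+ (d₀ ℕ.+ D)

LminusGE⇒LplusGE : ∀ k → LplusGEminus k
LminusGE⇒LplusGE k q L⁻ ε 0<ε D with D₀ , bound ← L⁻ ε 0<ε =
  D ℕ.+ D₀ , ℕ.m≤m+n D D₀ , bound (D ℕ.+ D₀) (ℕ.m≤n+m D₀ D)

open Asymptotics

-- The smallest of the four margins, in (c), is about 9 · 10⁻⁹.
δ : ℚ
δ = + 1 / 1000000000

0<δ : 0ℚ ℚ.< δ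
0<δ = toWitness {a? = 0ℚ ℚ.<? δ} _

just-above : (k a b : ℕ) .{{_ : ℕ.NonZero k}} .{{_ : ℕ.NonZero b}} → ℚ
just-above k a b = ((+ a / b) ℚ.* (+ 1 / k)) ^ℚ k ℚ.+ δ

theorem8 : (LplusGE 3 (+ 57 / 1000) × LminusGE 3 (+ 7 / 125)
    × RplusGT 3 115455 100000 × RminusGT 3 114775 100000)
    × (LplusGEminus 4 × LminusGE 4 (+ 25 / 3456) × RminusGT 4 116654 100000)
    × (LplusGEminus 5 × LminusGE 5 (+ 109 / 134456) × RminusGT 5 120431 100000)
theorem8 =
    -- The densities are 57/10³, 56/10³ = 7/125, 150/12⁴ = 25/3456 and 436/14⁵ = 109/134456. The odd
    -- T = 57 yields even degrees only and so serves the limit superior; 56 takes its place for the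
    -- limit inferior.
    ( upper template₅₇ (+ 57 / 1000)
    , lower template₅₆ (28 , refl) (+ 7 / 125)
    , (δ , 0<δ , upper template₅₇ (just-above 3 115455 100000))
    , (δ , 0<δ , lower template₅₆ (28 , refl) (just-above 3 114775 100000)))
  , ( LminusGE⇒LplusGE 4
    , lower template₁₅₀ (75 , refl) (+ 25 / 3456)
    , (δ , 0<δ , lower template₁₅₀ (75 , refl) (just-above 4 116654 100000)))
  , ( LminusGE⇒LplusGE 5
    , lower template₄₃₆ (218 , refl) (+ 109 / 134456)
    , (δ , 0<δ , lower template₄₃₆ (218 , refl) (just-above 5 120431 100000)))
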